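{- Let $G$ be a graph and let $k$ be a positive integer. Assume that $G$ is $(3k-3)$-edge-connected or $(2k-2)$-tree-connected. If there is a vertex set $Z\subseteq V(G)$ with $|E(G)|\equiv \sum_{v\in Z} d_G(v) \pmod k$, then $G$ can be edge-decomposed into $k$ factors $G_1,\ldots,G_k$ satisfying $\big||E(G_i)|-|E(G)|/k\big|<1$ for all $i$, such that for each $i$ and each vertex $v$, $$|d_{G_i}(v)-d_G(v)/k|<1.$$ Furthermore, the same conclusion holds if instead $G$ is a loopless $(2k-1)$-edge-connected essentially $(3k-3)$-edge-connected graph (with such a set $Z$).
   Context: Graphs are finite and may have loops and multiple edges; a loop contributes $2$ to the degree $d_G(v)$. A factor is a spanning subgraph; "edge-decomposed into factors $G_1,\ldots,G_k$" means $E(G)$ is partitioned into $E(G_1),\ldots,E(G_k)$ with each $G_i$ spanning. A graph is $m$-tree-connected if it contains $m$ edge-disjoint spanning trees. A graph is essentially $\lambda$-edge-connected if all edges of any edge cut of size strictly less than $\lambda$ are incident with a single vertex. -}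

module Defs where

open import Data.Nat using (ℕ; zero; suc; _+_; _*_; _∸_; _<_; _≤_; NonZero)
open import Data.Nat.DivMod using (_%_)
open import Data.Bool using (Bool; true; false; if_then_else_; _xor_; _∧_; not)
open import Data.Fin using (Fin; zero; suc)
open import Data.Fin.Properties using (_≟_)
open import Data.Maybe using (Maybe; just; nothing)
open import Data.Product using (_×_; _,_; proj₁; proj₂; ∃; Σ-syntax)
open import Data.Sum using (_⊎_)
open import Relation.Nullary using (¬_; does)
open import Relation.Binary.PropositionalEquality using (_≡_; _≢_)

-- A multigraph (loops and parallel edges allowed) on vertex set Fin n
-- with edge set Fin m; each edge is given by its (unordered) pair of ends.
Graph : ℕ → ℕ → Set
Graph n m = Fin m → Fin n × Fin n

sumFin : ∀ {m} → (Fin m → ℕ) → ℕ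
sumFin {zero}  f = 0
sumFin {suc m} f = f zero + sumFin (λ i → f (suc i))

count : ∀ {m} → (Fin m → Bool) → ℕ
count P = sumFin (λ i → if P i then 1 else 0)

eqᵇ : ∀ {n} → Fin n → Fin n → Bool
eqᵇ u v = does (u ≟ v)

-- Degree of v in the spanning subgraph with edge set F (a loop counts 2).
degIn : ∀ {n m} → Graph n m → (Fin m → Bool) → Fin n → ℕ
degIn G F v = sumFin (λ e → if F e
  then ((if eqᵇ (proj₁ (G e)) v then 1 else 0) + (if eqᵇ (proj₂ (G e)) v then 1 else 0))
  else 0)

deg : ∀ {n m} → Graph n m → Fin n → ℕ
deg G = degIn G (λ _ → true)

crosses : ∀ {n m} → Graph n m → (Fin n → Bool) → Fin m → Bool
crosses G S e = S (proj₁ (G e)) xor S (proj₂ (G e))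

cutSize : ∀ {n m} → Graph n m → (Fin n → Bool) → ℕ
cutSize G S = count (crosses G S)

Proper : ∀ {n} → (Fin n → Bool) → Set
Proper S = (∃ λ v → S v ≡ true) × (∃ λ v → S v ≡ false)

EdgeConnected : ∀ {n m} → Graph n m → ℕ → Set
EdgeConnected {n} G l = (S : Fin n → Bool) → Proper S → l ≤ cutSize G S

EssEdgeConnected : ∀ {n m} → Graph n m → ℕ → Set
EssEdgeConnected {n} {m} G l = (S : Fin n → Bool) → Proper S → cutSize G S < l →
  ∃ λ (v : Fin n) → (e : Fin m) → crosses G S e ≡ true →
    (proj₁ (G e) ≡ v) ⊎ (proj₂ (G e) ≡ v)

Loopless : ∀ {n m} → Graph n m → Set
Loopless G = ∀ e → proj₁ (G e) ≢ proj₂ (G e)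

data Reach {n m} (G : Graph n m) (F : Fin m → Bool) (u : Fin n) : Fin n → Set where
  here : Reach G F u u
  fwd  : ∀ {w} e → Reach G F u w → F e ≡ true → proj₁ (G e) ≡ w → Reach G F u (proj₂ (G e))
  bwd  : ∀ {w} e → Reach G F u w → F e ≡ true → proj₂ (G e) ≡ w → Reach G F u (proj₁ (G e))

ConnectedSub : ∀ {n m} → Graph n m → (Fin m → Bool) → Set
ConnectedSub G F = ∀ u v → Reach G F u v

without : ∀ {m} → (Fin m → Bool) → Fin m → (Fin m → Bool)
without F e f = F f ∧ not (eqᵇ e f)

-- Acyclic: no edge lies on a cycle, i.e. for no edge e of F are its ends
-- joined by a walk in F - e (a loop is a cycle of length 1).
Acyclic : ∀ {n m} → Graph n m → (Fin m → Bool) → Set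
Acyclic G F = ∀ e → F e ≡ true → ¬ Reach G (without F e) (proj₁ (G e)) (proj₂ (G e))

SpanningTree : ∀ {n m} → Graph n m → (Fin m → Bool) → Set
SpanningTree G F = ConnectedSub G F × Acyclic G F

-- t-tree-connected: t edge-disjoint spanning trees; each edge is assigned
-- to at most one tree (nothing = unused), and each class is a spanning tree.
TreeConnected : ∀ {n m} → Graph n m → ℕ → Set
TreeConnected {n} {m} G t = Σ[ a ∈ (Fin m → Maybe (Fin t)) ]
  ((j : Fin t) → SpanningTree G (λ e → inClass (a e) j))
  where
  inClass : Maybe (Fin t) → Fin t → Bool
  inClass nothing  j = false
  inClass (just i) j = eqᵇ i j

colour : ∀ {m k} → (Fin m → Fin k) → Fin k → (Fin m → Bool)
colour c i e = eqᵇ (c e) i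

degSum : ∀ {n m} → Graph n m → (Fin n → Bool) → ℕ
degSum G Z = sumFin (λ v → if Z v then deg G v else 0)

-- |x - y/k| < 1, written as |k x - y| < k.
CloseTo : ℕ → ℕ → ℕ → Set
CloseTo k x y = (k * x < y + k) × (y < k * x + k)

{-# OPTIONS --safe #-}

-- Write k = κ + 1 and deg v = k q(v) + b(v) with b(v) < k. Each hypothesis yields κ edge-disjoint
-- connected spanning subgraphs: 2κ-edge-connectivity does so by Nash-Williams' theorem.
-- Both Z and its complement have degree sum ≡ |E| mod k, so one can choose for every vertex v a set
-- S(v) of b(v) colours such that every colour i satisfies Σ (q(v) + [i ∈ S(v)]) ≡ 0 mod 2. Taking a
-- T-join in each of the κ subgraphs and the remaining edges as last class gives a colouring with
-- d_i(v) ≡ q(v) + [i ∈ S(v)] mod 2 for all i and v.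
-- An auxiliary graph (Gadget) absorbs the sets S(v), so that at each of its vertices all colours have
-- the same parity. Exchanging two colours along suitable closed trails keeps the parities and makes
-- any two colour degrees at a vertex differ by at most 2. At a vertex whose degree is k times a
-- number of the right parity, all colour degrees are then equal, which gives the theorem.
module Submission where

open import Defs
open import Data.Bool using (Bool; true; false; if_then_else_; _xor_; _∧_; _∨_; not)
open import Data.Bool.Properties as Boolₚ using (xor-assoc; xor-comm; xor-same; not-distribˡ-xor)
open import Data.Empty using (⊥; ⊥-elim)
open import Data.Fin using (Fin; zero; suc; toℕ; splitAt; _↑ˡ_; _↑ʳ_; combine; remQuot; inject≤)
open import Data.Fin.Properties as Finₚ using (any?; all?)
open import Data.Maybe using (Maybe; just; nothing)
open import Data.Nat using (ℕ; zero; suc; _+_; _*_; _∸_; _/_; _%_; _≤_; _<_; z≤n; s≤s; z<s; NonZero)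
open import Data.Nat.DivMod using (_mod_; m%n<n; m≡m%n+[m/n]*n; [m+n]%n≡m%n; [m+kn]%n≡m%n; m<n⇒m%n≡m)
open import Data.Nat.Properties
open import Algebra.Properties.CommutativeSemigroup +-commutativeSemigroup using (interchange)
open import Data.Nat.Solver using (module +-*-Solver)
open import Data.Product using (_×_; _,_; proj₁; proj₂; ∃; Σ-syntax)
open import Data.Sum using (_⊎_; inj₁; inj₂)
open import Function using (_∘_; id)
open import Relation.Binary using (tri<; tri≈; tri>)
open import Relation.Binary.PropositionalEquality hiding (J)
open import Relation.Nullary using (¬_; Dec; yes; no; does; contradiction; ¬?)
open import Relation.Nullary.Decidable using (_×-dec_; map′; decidable-stable)

-- Sums over Fin, and parities

-- T-joins control colour degrees only modulo 2, and an exchange that keeps parities moves edge ends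
-- in pairs, so a difference of exactly 2 may survive. Being within 2 determines the degrees only
-- where their mean is an integer of the same parity as all of them. In `G` both fail: the mean at v
-- is q(v) + b(v)/k, and the wanted values q(v) and q(v) + 1 have different parities. The auxiliary
-- graph repairs both at once: k - b(v) new edges at v, one for each colour outside S(v), raise the
-- mean to q(v) + 1 and give every colour that parity. They start at a companion of degree k, where
-- the mean is 1; after balancing each colour has exactly one edge there, so removing the new edges
-- costs v at most one end of each colour. The colours that finally have q(v) + 1 ends at v may
-- differ from S(v), which only serves to get the parities right. The evenness of Σ (q(v) +
-- [i ∈ S(v)]) is used twice: it is the solvability condition for the T-joins, and it equalizes the
-- parities at the common vertex of the auxiliary graph.

⟦_⟧ : Bool → ℕ
⟦ b ⟧ = if b then 1 else 0

sum-cong : ∀ {m} {f g : Fin m → ℕ} → (∀ i → f i ≡ g i) → sumFin f ≡ sumFin g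
sum-cong {zero}  h = refl
sum-cong {suc m} h = cong₂ _+_ (h zero) (sum-cong (h ∘ suc))

sum-+ : ∀ {m} (f g : Fin m → ℕ) → sumFin (λ i → f i + g i) ≡ sumFin f + sumFin g
sum-+ {zero}  f g = refl
sum-+ {suc m} f g = trans (cong (f zero + g zero +_) (sum-+ (f ∘ suc) (g ∘ suc)))
  (interchange (f zero) (g zero) _ _)

sum-const : ∀ m c → sumFin {m} (λ _ → c) ≡ m * c
sum-const zero    c = refl
sum-const (suc m) c = cong (c +_) (sum-const m c)

sum-0 : ∀ m → sumFin {m} (λ _ → 0) ≡ 0
sum-0 m = trans (sum-const m 0) (*-zeroʳ m)

sum-* : ∀ {m} c (f : Fin m → ℕ) → sumFin (λ i → c * f i) ≡ c * sumFin f
sum-* {zero}  c f = sym (*-zeroʳ c)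
sum-* {suc m} c f = trans (cong (c * f zero +_) (sum-* c (f ∘ suc)))
  (sym (*-distribˡ-+ c (f zero) _))

sum-mono : ∀ {m} {f g : Fin m → ℕ} → (∀ i → f i ≤ g i) → sumFin f ≤ sumFin g
sum-mono {zero}  h = z≤n
sum-mono {suc m} h = +-mono-≤ (h zero) (sum-mono (h ∘ suc))

sum-mono-< : ∀ {m} {f g : Fin m → ℕ} → (∀ i → f i ≤ g i) → (i : Fin m) → f i < g i → sumFin f < sumFin g
sum-mono-< h zero    lt = +-mono-<-≤ lt (sum-mono (h ∘ suc))
sum-mono-< h (suc i) lt = +-mono-≤-< (h zero) (sum-mono-< (h ∘ suc) i lt)

sum-<-∃ : ∀ {m} (f g : Fin m → ℕ) → sumFin f < sumFin g → ∃ λ i → f i < g i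
sum-<-∃ f g lt with any? (λ i → f i <? g i)
... | yes p = p
... | no ¬p = contradiction lt (≤⇒≯ (sum-mono (λ i → ≮⇒≥ (λ q → ¬p (i , q)))))

sum-swap : ∀ {m n} (f : Fin m → Fin n → ℕ) →
  sumFin (λ i → sumFin (f i)) ≡ sumFin (λ j → sumFin (λ i → f i j))
sum-swap {zero}  {n} f = sym (sum-0 n)
sum-swap {suc m}     f = trans (cong (sumFin (f zero) +_) (sum-swap (f ∘ suc)))
  (sym (sum-+ (f zero) _))

eqᵇ-refl : ∀ {n} (u : Fin n) → eqᵇ u u ≡ true
eqᵇ-refl u with u Finₚ.≟ u
... | yes _ = refl
... | no ¬p = contradiction refl ¬p

eqᵇ-≢ : ∀ {n} {u v : Fin n} → u ≢ v → eqᵇ u v ≡ false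
eqᵇ-≢ {u = u} {v} h with u Finₚ.≟ v
... | yes p = contradiction p h
... | no _  = refl

eqᵇ-≡ : ∀ {n} {u v : Fin n} → eqᵇ u v ≡ true → u ≡ v
eqᵇ-≡ {u = u} {v} h with u Finₚ.≟ v
... | yes p = p

eqᵇ-sym : ∀ {n} (u v : Fin n) → eqᵇ u v ≡ eqᵇ v u
eqᵇ-sym u v with u Finₚ.≟ v
... | yes refl = sym (eqᵇ-refl u)
... | no ¬p    = sym (eqᵇ-≢ (¬p ∘ sym))

eqᵇ-suc : ∀ {n} (u v : Fin n) → eqᵇ (suc u) (suc v) ≡ eqᵇ u v
eqᵇ-suc u v with u Finₚ.≟ v
... | yes _ = refl
... | no  _ = refl

sum-δ : ∀ {m} (j : Fin m) (f : Fin m → ℕ) → sumFin (λ i → if eqᵇ j i then f i else 0) ≡ f j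
sum-δ {suc m} zero    f = trans (cong (f zero +_) (sum-0 m)) (+-identityʳ _)
sum-δ {suc m} (suc j) f = trans
  (sum-cong (λ i → cong (λ b → if b then f (suc i) else 0) (eqᵇ-suc j i)))
  (sum-δ j (f ∘ suc))

count-eqᵇ : ∀ {m} (j : Fin m) → sumFin (λ i → ⟦ eqᵇ j i ⟧) ≡ 1
count-eqᵇ j = sum-δ j (λ _ → 1)

odd : ℕ → Bool
odd zero    = false
odd (suc n) = not (odd n)

xor-interchange : ∀ a b c d → (a xor b) xor (c xor d) ≡ (a xor c) xor (b xor d)
xor-interchange a b c d = begin
  (a xor b) xor (c xor d) ≡⟨ xor-assoc a b (c xor d) ⟩
  a xor (b xor (c xor d)) ≡⟨ cong (a xor_) (xor-assoc b c d) ⟨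
  a xor ((b xor c) xor d) ≡⟨ cong (λ x → a xor (x xor d)) (xor-comm b c) ⟩
  a xor ((c xor b) xor d) ≡⟨ cong (a xor_) (xor-assoc c b d) ⟩
  a xor (c xor (b xor d)) ≡⟨ xor-assoc a c (b xor d) ⟨
  (a xor c) xor (b xor d) ∎
  where open ≡-Reasoning

odd-+ : ∀ a b → odd (a + b) ≡ odd a xor odd b
odd-+ zero    b = refl
odd-+ (suc a) b = trans (cong not (odd-+ a b)) (not-distribˡ-xor (odd a) (odd b))

odd-⟦⟧ : ∀ b → odd ⟦ b ⟧ ≡ b
odd-⟦⟧ true  = refl
odd-⟦⟧ false = refl

odd-double : ∀ n → odd (n + n) ≡ false
odd-double n = trans (odd-+ n n) (xor-same (odd n))

⊕ : ∀ {m} → (Fin m → Bool) → Bool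
⊕ {zero}  f = false
⊕ {suc m} f = f zero xor ⊕ (f ∘ suc)

⊕-cong : ∀ {m} {f g : Fin m → Bool} → (∀ i → f i ≡ g i) → ⊕ f ≡ ⊕ g
⊕-cong {zero}  h = refl
⊕-cong {suc m} h = cong₂ _xor_ (h zero) (⊕-cong (h ∘ suc))

⊕-xor : ∀ {m} (f g : Fin m → Bool) → ⊕ (λ i → f i xor g i) ≡ ⊕ f xor ⊕ g
⊕-xor {zero}  f g = refl
⊕-xor {suc m} f g = trans (cong ((f zero xor g zero) xor_) (⊕-xor (f ∘ suc) (g ∘ suc)))
  (xor-interchange (f zero) (g zero) _ _)

odd-sum : ∀ {m} (f : Fin m → ℕ) → odd (sumFin f) ≡ ⊕ (odd ∘ f)
odd-sum {zero}  f = refl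
odd-sum {suc m} f = trans (odd-+ (f zero) _) (cong (odd (f zero) xor_) (odd-sum (f ∘ suc)))

⊕-false : ∀ m → ⊕ {m} (λ _ → false) ≡ false
⊕-false zero    = refl
⊕-false (suc m) = ⊕-false m

∧-elimˡ : ∀ {a b} → a ∧ b ≡ true → a ≡ true
∧-elimˡ {true} _ = refl

∧-elimʳ : ∀ {a b} → a ∧ b ≡ true → b ≡ true
∧-elimʳ {true} h = h

∧-intro : ∀ {a b} → a ≡ true → b ≡ true → a ∧ b ≡ true
∧-intro refl refl = refl

true≢false : ∀ {b} → b ≡ true → b ≡ false → ⊥
true≢false refl ()

¬true : ∀ {b} → ¬ (b ≡ true) → b ≡ false
¬true {true}  h = contradiction refl h
¬true {false} _ = refl

not-true : ∀ {b} → not b ≡ true → b ≡ false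
not-true {false} _ = refl

⟦⟧-pos : ∀ {b} → 0 < ⟦ b ⟧ → b ≡ true
⟦⟧-pos {true} _ = refl

xor-false : ∀ {x y} → x xor y ≡ false → x ≡ y
xor-false {true}  {true}  _ = refl
xor-false {false} {false} _ = refl

-- Walks and quotients

_⊑_ : ∀ {m} → (Fin m → Bool) → (Fin m → Bool) → Set
F ⊑ F' = ∀ e → F e ≡ true → F' e ≡ true

module _ {n m} {G : Graph n m} where

  reach-trans : ∀ {F u v w} → Reach G F u v → Reach G F v w → Reach G F u w
  reach-trans p here           = p
  reach-trans p (fwd e q Fe h) = fwd e (reach-trans p q) Fe h
  reach-trans p (bwd e q Fe h) = bwd e (reach-trans p q) Fe h

  reach-edge : ∀ {F} e → F e ≡ true → Reach G F (proj₁ (G e)) (proj₂ (G e))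
  reach-edge e Fe = fwd e here Fe refl

  reach-edge′ : ∀ {F} e → F e ≡ true → Reach G F (proj₂ (G e)) (proj₁ (G e))
  reach-edge′ e Fe = bwd e here Fe refl

  reach-sym : ∀ {F u v} → Reach G F u v → Reach G F v u
  reach-sym here              = here
  reach-sym (fwd e p Fe refl) = reach-trans (reach-edge′ e Fe) (reach-sym p)
  reach-sym (bwd e p Fe refl) = reach-trans (reach-edge e Fe) (reach-sym p)

  reach-bind : ∀ {F F' u v} →
    (∀ e → F e ≡ true → Reach G F' (proj₁ (G e)) (proj₂ (G e))) →
    Reach G F u v → Reach G F' u v
  reach-bind h here              = here
  reach-bind h (fwd e p Fe refl) = reach-trans (reach-bind h p) (h e Fe)
  reach-bind h (bwd e p Fe refl) = reach-trans (reach-bind h p) (reach-sym (h e Fe))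

  reach-mono : ∀ {F F' u v} → F ⊑ F' → Reach G F u v → Reach G F' u v
  reach-mono h = reach-bind (λ e Fe → reach-edge e (h e Fe))

  Closed : (Fin m → Bool) → (Fin n → Bool) → Set
  Closed F S = ∀ e → F e ≡ true → crosses G S e ≡ false

  closed-reach : ∀ {F u v} S → Closed F S → Reach G F u v → S u ≡ S v
  closed-reach S c here            = refl
  closed-reach S c (fwd e p Fe refl) = trans (closed-reach S c p) (xor-false (c e Fe))
  closed-reach S c (bwd e p Fe refl) = trans (closed-reach S c p) (sym (xor-false (c e Fe)))

  private
    insert : (Fin n → Bool) → Fin n → Fin n → Bool
    insert S z v = S v ∨ eqᵇ z v

    insert-< : ∀ S z → S z ≡ false → count (not ∘ insert S z) < count (not ∘ S)
    insert-< S z h = sum-mono-< le z lt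
      where
      le : ∀ v → ⟦ not (S v ∨ eqᵇ z v) ⟧ ≤ ⟦ not (S v) ⟧
      le v with S v
      ... | true = z≤n
      ... | false with eqᵇ z v
      ...   | true  = z≤n
      ...   | false = ≤-refl
      lt : ⟦ not (S z ∨ eqᵇ z z) ⟧ < ⟦ not (S z) ⟧
      lt rewrite h | eqᵇ-refl z = z<s

    insert-reach : ∀ {F u S z} → (∀ v → S v ≡ true → Reach G F u v) → Reach G F u z →
      ∀ v → insert S z v ≡ true → Reach G F u v
    insert-reach {S = S} {z} h p v eq with S v in Sv
    ... | true = h v Sv
    ... | false = subst (Reach G _ _) (eqᵇ-≡ eq) p

  -- `Reach` puts no bound on the length of a walk. A set that is both reachable and closed decides
  -- it nevertheless: membership yields a walk, and closedness refutes any walk to a vertex outside.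
  reachSet : ∀ F u → Σ[ S ∈ (Fin n → Bool) ]
    S u ≡ true × (∀ v → S v ≡ true → Reach G F u v) × Closed F S
  reachSet F u = grow _ (eqᵇ u) ≤-refl (eqᵇ-refl u)
      (λ v h → subst (Reach G F u) (eqᵇ-≡ h) here)
    where
    grow : ∀ fuel S → count (not ∘ S) ≤ fuel → S u ≡ true → (∀ v → S v ≡ true → Reach G F u v) →
      Σ[ S ∈ (Fin n → Bool) ] S u ≡ true × (∀ v → S v ≡ true → Reach G F u v) × Closed F S
    add : ∀ fuel S → count (not ∘ S) ≤ fuel → S u ≡ true → (∀ v → S v ≡ true → Reach G F u v) →
      ∀ z → S z ≡ false → Reach G F u z →
      Σ[ S ∈ (Fin n → Bool) ] S u ≡ true × (∀ v → S v ≡ true → Reach G F u v) × Closed F S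
    grow fuel S b Su h with any? (λ e → (F e ∧ crosses G S e) Boolₚ.≟ true)
    ... | no ¬p = S , Su , h , λ e Fe → ¬true (λ c → ¬p (e , ∧-intro Fe c))
    ... | yes (e , p) with S (proj₁ (G e)) in S₁ | S (proj₂ (G e)) in S₂ | ∧-elimʳ {F e} p
    ...   | true  | false | _ = add fuel S b Su h _ S₂ (fwd e (h _ S₁) (∧-elimˡ p) refl)
    ...   | false | true  | _ = add fuel S b Su h _ S₁ (bwd e (h _ S₂) (∧-elimˡ p) refl)
    add zero S b Su h z Sz r = contradiction (insert-< S z Sz) (≤⇒≯ (≤-trans b z≤n))
    add (suc fuel) S b Su h z Sz r = grow fuel (insert S z)
      (≤-pred (≤-trans (insert-< S z Sz) b)) (cong (_∨ eqᵇ z u) Su) (insert-reach h r)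

  reach? : ∀ F u v → Dec (Reach G F u v)
  reach? F u v with reachSet F u
  ... | S , Su , h , c with S v in Sv
  ...   | true  = yes (h v Sv)
  ...   | false = no λ p → true≢false Su (trans (closed-reach S c p) Sv)

  -- The edge f through which a walk leaves W for the last time; p and q are its ends.
  last-exit : ∀ {F W u v} → W u ≡ true → W v ≡ false → Reach G F u v →
    ∃ λ f → F f ≡ true × crosses G W f ≡ true × ∃ λ p → ∃ λ q → W p ≡ true
      × Reach G (λ e → F e ∧ not (crosses G W e)) q v
      × (∀ {F'} → Reach G F' p q → Reach G F' (proj₁ (G f)) (proj₂ (G f)))
  last-exit Wu Wv here = ⊥-elim (true≢false Wu Wv)
  last-exit {F} {W} Wu Wv (fwd e r Fe refl) with W (proj₁ (G e)) in W₁
  ... | true = e , Fe , cong₂ _xor_ W₁ Wv , _ , _ , W₁ , here , id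
  ... | false with last-exit Wu W₁ r
  ...   | f , Ff , cf , p , q , Wp , out , ends = f , Ff , cf , p , q , Wp
          , fwd e out (∧-intro Fe (cong not (cong₂ _xor_ W₁ Wv))) refl , ends
  last-exit {F} {W} Wu Wv (bwd e r Fe refl) with W (proj₂ (G e)) in W₂
  ... | true = e , Fe , cong₂ _xor_ Wv W₂ , _ , _ , W₂ , here , reach-sym
  ... | false with last-exit Wu W₂ r
  ...   | f , Ff , cf , p , q , Wp , out , ends = f , Ff , cf , p , q , Wp
          , bwd e out (∧-intro Fe (cong not (cong₂ _xor_ Wv W₂))) refl , ends

relabel : ∀ {n r m} → (Fin n → Fin r) → Graph n m → Graph r m
relabel ψ G e = ψ (proj₁ (G e)) , ψ (proj₂ (G e))

-- Classes are numbered by `Fin size`, so that contracting yields a `Graph` again. `size<` is what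
-- makes inductions by contraction descend.
record Quotient {n} (_≈_ : Fin n → Fin n → Set) : Set where
  field
    size  : ℕ
    class : Fin n → Fin size
    onto  : ∀ x → ∃ λ u → class u ≡ x
    sound : ∀ {u v} → u ≈ v → class u ≡ class v
    exact : ∀ {u v} → class u ≡ class v → u ≈ v
    size≤ : size ≤ n
    size< : ∀ u v → u ≢ v → u ≈ v → size < n

quotient : ∀ {n} (_≈_ : Fin n → Fin n → Set) → (∀ u v → Dec (u ≈ v)) →
  (∀ {u} → u ≈ u) → (∀ {u v} → u ≈ v → v ≈ u) → (∀ {u v w} → u ≈ v → v ≈ w → u ≈ w) →
  Quotient _≈_
quotient {zero} _≈_ dec rfl sy tr = record
  { size = 0 ; class = λ () ; onto = λ () ; sound = λ { {()} } ; exact = λ { {()} }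
  ; size≤ = z≤n ; size< = λ () }
quotient {suc n} _≈_ dec rfl sy tr with quotient (λ u v → suc u ≈ suc v) (λ u v → dec (suc u) (suc v)) rfl sy tr
                                      | any? (λ v → dec zero (suc v))
... | Q | yes (w , p) = record
  { size = size ; class = cl ; onto = λ x → let u , e = onto x in suc u , e
  ; sound = sd ; exact = ex ; size≤ = m≤n⇒m≤1+n size≤ ; size< = λ _ _ _ _ → s≤s size≤ }
  where
  open Quotient Q
  cl : Fin (suc n) → Fin size
  cl zero    = class w
  cl (suc v) = class v
  sd : ∀ {u v} → u ≈ v → cl u ≡ cl v
  sd {zero}  {zero}  q = refl
  sd {zero}  {suc v} q = sound (tr (sy p) q)
  sd {suc u} {zero}  q = sound (tr q p)
  sd {suc u} {suc v} q = sound q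
  ex : ∀ {u v} → cl u ≡ cl v → u ≈ v
  ex {zero}  {zero}  q = rfl
  ex {zero}  {suc v} q = tr p (exact q)
  ex {suc u} {zero}  q = tr (exact q) (sy p)
  ex {suc u} {suc v} q = exact q
... | Q | no ¬p = record
  { size = suc size ; class = cl ; onto = on
  ; sound = sd ; exact = ex ; size≤ = s≤s size≤ ; size< = lt }
  where
  open Quotient Q
  cl : Fin (suc n) → Fin (suc size)
  cl zero    = zero
  cl (suc v) = suc (class v)
  on : ∀ x → ∃ λ u → cl u ≡ x
  on zero = zero , refl
  on (suc x) = let u , e = onto x in suc u , cong suc e
  sd : ∀ {u v} → u ≈ v → cl u ≡ cl v
  sd {zero}  {zero}  q = refl
  sd {zero}  {suc v} q = contradiction (v , q) ¬p
  sd {suc u} {zero}  q = contradiction (u , sy q) ¬p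
  sd {suc u} {suc v} q = cong suc (sound q)
  ex : ∀ {u v} → cl u ≡ cl v → u ≈ v
  ex {zero}  {zero}  q = rfl
  ex {suc u} {suc v} q = exact (Finₚ.suc-injective q)
  lt : ∀ u v → u ≢ v → u ≈ v → suc size < suc n
  lt zero    zero    h q = contradiction refl h
  lt zero    (suc v) h q = contradiction (v , q) ¬p
  lt (suc u) zero    h q = contradiction (u , sy q) ¬p
  lt (suc u) (suc v) h q = s≤s (size< u v (h ∘ cong suc) q)

-- Packing spanning connected subgraphs

-- Lifts a walk from the contracted graph: `step` replaces its edges, and `glue` walks inside a
-- class from the end of one edge to the start of the next.
reach-lift : ∀ {n r m} {G : Graph n m} {ψ : Fin n → Fin r} {F F' : Fin m → Bool} →
  (∀ {u v} → ψ u ≡ ψ v → Reach G F' u v) →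
  (∀ e → F e ≡ true → Reach G F' (proj₁ (G e)) (proj₂ (G e))) →
  ∀ {x y} → Reach (relabel ψ G) F x y → ∀ {u v} → ψ u ≡ x → ψ v ≡ y → Reach G F' u v
reach-lift glue step here p q = glue (trans p (sym q))
reach-lift glue step (fwd e r Fe refl) p q =
  reach-trans (reach-lift glue step r p refl) (reach-trans (step e Fe) (glue (sym q)))
reach-lift glue step (bwd e r Fe refl) p q =
  reach-trans (reach-lift glue step r p refl) (reach-trans (reach-sym (step e Fe)) (glue (sym q)))

without-⊑ : ∀ {m} (F : Fin m → Bool) e → without F e ⊑ F
without-⊑ F e f = ∧-elimˡ

without-intro : ∀ {m} (F : Fin m → Bool) e f → F f ≡ true → e ≢ f → without F e f ≡ true
without-intro F e f Ff h = ∧-intro Ff (cong not (eqᵇ-≢ h))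

without-≢ : ∀ {m} (F : Fin m → Bool) e f → without F e f ≡ true → e ≢ f
without-≢ F e f h refl = true≢false (∧-elimʳ {F e} h) (cong not (eqᵇ-refl e))

count-without : ∀ {m} (F : Fin m → Bool) e → F e ≡ true → count F ≡ suc (count (without F e))
count-without F e Fe = begin
  count F ≡⟨ sum-cong pt ⟩
  sumFin (λ f → ⟦ eqᵇ e f ⟧ + ⟦ without F e f ⟧) ≡⟨ sum-+ (λ f → ⟦ eqᵇ e f ⟧) (λ f → ⟦ without F e f ⟧) ⟩
  sumFin (λ f → ⟦ eqᵇ e f ⟧) + count (without F e) ≡⟨ cong (_+ count (without F e)) (count-eqᵇ e) ⟩
  suc (count (without F e)) ∎
  where
  open ≡-Reasoning
  pt : ∀ f → ⟦ F f ⟧ ≡ ⟦ eqᵇ e f ⟧ + ⟦ without F e f ⟧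
  pt f with e Finₚ.≟ f
  ... | yes refl rewrite Fe = refl
  ... | no _ with F f
  ...   | true  = refl
  ...   | false = refl

-- Contracting one edge `e` of the forest loses a vertex, and a cycle among the remaining edges of
-- the quotient would lift, through `e`, to a cycle of `F`.
forest-bound : ∀ c {n m} (G : Graph n m) (F : Fin m → Bool) → count F ≡ c → Acyclic G F →
  1 ≤ n → c < n
forest-bound zero    G F h ac 1≤n = 1≤n
forest-bound (suc c) {n} {m} G F h ac 1≤n with sum-<-∃ (λ _ → 0) (λ e → ⟦ F e ⟧)
    (subst₂ _<_ (sym (sum-0 m)) (sym h) z<s)
... | e , lt = <-≤-trans (s≤s (forest-bound c (relabel class G) (without F e)
                 (suc-injective (trans (sym (count-without F e Fe)) h)) ac' 1≤size))
                 (size< _ _ nonloop (reach-edge e (eqᵇ-refl e)))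
  where
  Fe : F e ≡ true
  Fe = ⟦⟧-pos lt
  open Quotient (quotient (Reach G (eqᵇ e)) (reach? (eqᵇ e)) here reach-sym reach-trans)
  nonloop : proj₁ (G e) ≢ proj₂ (G e)
  nonloop eq = ac e Fe (subst (Reach G _ _) eq here)
  1≤size : 1 ≤ size
  1≤size with size | class (proj₁ (G e))
  ... | suc _ | _ = s≤s z≤n
  ac' : Acyclic (relabel class G) (without F e)
  ac' f F'f p = ac f (without-⊑ F e f F'f) (reach-lift glue step p refl refl)
    where
    glue : ∀ {u v} → class u ≡ class v → Reach G (without F f) u v
    glue q = reach-mono (λ g eg → subst (λ g → without F f g ≡ true) (eqᵇ-≡ eg)
      (without-intro F f e Fe (without-≢ F e f F'f ∘ sym))) (exact q)
    step : ∀ g → without (without F e) f g ≡ true → Reach G (without F f) (proj₁ (G g)) (proj₂ (G g))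
    step g h = reach-edge g (without-intro F f g (without-⊑ F e g (without-⊑ (without F e) f g h))
                                           (without-≢ (without F e) f g h))

-- If `a` is not maximal, a strictly better element exists, and after `B` improvements the bound
-- would be exceeded. `A` cannot be searched, whence the double negation.
maximal : ∀ {A : Set} (f : A → ℕ) B → (∀ a → f a ≤ B) → A → ¬ ¬ (∃ λ a → ∀ a' → f a' ≤ f a)
maximal {A} f B bd a k = go B a (m≤n+m B (f a))
  where
  go : ∀ d a → B ≤ f a + d → ⊥
  go zero    a le = k (a , λ a' → ≤-trans (bd a') (subst (B ≤_) (+-identityʳ _) le))
  go (suc d) a le = k (a , best)
    where
    best : ∀ a' → f a' ≤ f a
    best a' with f a' ≤? f a
    ... | yes p = p
    ... | no ¬p = ⊥-elim (go d a' (≤-trans le (subst (_≤ f a' + d) (sym (+-suc (f a) d))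
                    (+-monoˡ-≤ d (≰⇒> ¬p)))))

-- Towards a double negation, finitely many instances of excluded middle may be assumed at once.
-- This serves `Free`, which quantifies over sequences of moves of any length.
¬¬-decide : ∀ {m} (P : Fin m → Set) → ¬ ¬ (∀ i → Dec (P i))
¬¬-decide {zero}  P k = k λ ()
¬¬-decide {suc m} P k = ¬¬-decide (P ∘ suc) λ d →
  let with₀ : Dec (P zero) → ⊥
      with₀ d₀ = k λ { zero → d₀ ; (suc i) → d i }
  in with₀ (no (with₀ ∘ yes))

recolour : ∀ {m t} → (Fin m → Fin t) → Fin m → Fin t → (Fin m → Fin t)
recolour a e i f = if eqᵇ e f then i else a f

colour-≡ : ∀ {m k} (a : Fin m → Fin k) {i} e → colour a i e ≡ true → a e ≡ i
colour-≡ a e = eqᵇ-≡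

recolour-new : ∀ {m t} (a : Fin m → Fin t) e i → colour (recolour a e i) i e ≡ true
recolour-new a e i rewrite eqᵇ-refl e = eqᵇ-refl i

recolour-old : ∀ {m t} (a : Fin m → Fin t) e j {i} → without (colour a i) e ⊑ colour (recolour a e j) i
recolour-old a e j f h rewrite eqᵇ-≢ (without-≢ (colour a _) e f h) = ∧-elimˡ h

does-mono : ∀ {P Q : Set} (p : Dec P) (q : Dec Q) → (P → Q) → ⟦ does p ⟧ ≤ ⟦ does q ⟧
does-mono (yes p) (yes q) h = ≤-refl
does-mono (yes p) (no ¬q) h = contradiction (h p) ¬q
does-mono (no ¬p) q       h = z≤n

does-< : ∀ {P Q : Set} (p : Dec P) (q : Dec Q) → ¬ P → Q → ⟦ does p ⟧ < ⟦ does q ⟧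
does-< (yes p) q       ¬p q' = contradiction p ¬p
does-< (no _)  (yes q) ¬p q' = z<s
does-< (no _)  (no ¬q) ¬p q' = contradiction q' ¬q

-- Extremal colourings and their free edges

module Extremal {r m t : ℕ} (G : Graph r m) where

  src tgt : Fin m → Fin r
  src e = proj₁ (G e)
  tgt e = proj₂ (G e)

  linked? : (a : Fin m → Fin t) → ∀ i u v → Dec (Reach G (colour a i) u v)
  linked? a i = reach? (colour a i)

  -- The quantity to be maximized. Its largest conceivable value, `t * r * r`, means that every
  -- colour class is connected and spanning.
  linkage : (Fin m → Fin t) → ℕ
  linkage a = sumFin λ i → sumFin λ u → sumFin λ v → ⟦ does (linked? a i u v) ⟧

  linkage-bound : ∀ a → linkage a ≤ t * (r * (r * 1))
  linkage-bound a = ≤-trans (sum-mono λ i → ≤-trans (sum-mono λ u →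
      ≤-trans (sum-mono λ v → ⟦⟧≤1 (does (linked? a i u v)))
      (≤-reflexive (sum-const r 1))) (≤-reflexive (sum-const r _))) (≤-reflexive (sum-const t _))
    where
    ⟦⟧≤1 : ∀ b → ⟦ b ⟧ ≤ 1
    ⟦⟧≤1 true  = ≤-refl
    ⟦⟧≤1 false = z≤n

  linkage-< : ∀ a b → (∀ {i u v} → Reach G (colour a i) u v → Reach G (colour b i) u v) →
    ∀ i u v → ¬ Reach G (colour a i) u v → Reach G (colour b i) u v → linkage a < linkage b
  linkage-< a b h i u v ¬p q =
    sum-mono-< (λ i → sum-mono λ u → sum-mono λ v → le i u v) i
      (sum-mono-< (λ u → sum-mono λ v → le i u v) u
        (sum-mono-< (le i u) v (does-< (linked? a i u v) (linked? b i u v) ¬p q)))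
    where
    le : ∀ i u v → ⟦ does (linked? a i u v) ⟧ ≤ ⟦ does (linked? b i u v) ⟧
    le i u v = does-mono (linked? a i u v) (linked? b i u v) h

  Redundant : (Fin m → Fin t) → Fin m → Set
  Redundant a e = Reach G (without (colour a (a e)) e) (src e) (tgt e)

  -- A move recolours an edge that its class can spare, so it disconnects nothing. Hence every
  -- colouring reached from one of maximal linkage has maximal linkage too.
  data _↝_ (a : Fin m → Fin t) : (Fin m → Fin t) → Set where
    stop : a ↝ a
    move : ∀ {b} → a ↝ b → ∀ e → Redundant b e → ∀ i → a ↝ recolour b e i

  Free : (Fin m → Fin t) → Fin m → Set
  Free a e = ∃ λ b → a ↝ b × Redundant b e

  ↝-reach : ∀ {a b} → a ↝ b → ∀ {i u v} → Reach G (colour a i) u v → Reach G (colour b i) u v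
  ↝-reach stop p = p
  ↝-reach {a} (move {b} s e red j) {i} p = reach-bind step (↝-reach s p)
    where
    step : ∀ f → colour b i f ≡ true → Reach G (colour (recolour b e j) i) (src f) (tgt f)
    step f h with e Finₚ.≟ f
    ... | no e≢f = reach-edge f (recolour-old b e j f (without-intro (colour b i) e f h e≢f))
    ... | yes refl = reach-mono (recolour-old b e j)
      (subst (λ i → Reach G (without (colour b i) e) (src e) (tgt e)) (colour-≡ b e h) red)

  module Maximal (a : Fin m → Fin t) (best : ∀ b → linkage b ≤ linkage a) where

    -- Otherwise giving `e` the colour `i` would newly join its ends in class `i`, while its old
    -- class loses nothing because `e` is redundant; the linkage would rise.
    spanned : ∀ {b} → a ↝ b → ∀ e → Redundant b e → ∀ i →
      Reach G (without (colour b i) e) (src e) (tgt e)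
    spanned {b} s e red i with b e Finₚ.≟ i
    ... | yes refl = red
    ... | no be≢i with reach? (without (colour b i) e) (src e) (tgt e)
    ...   | yes p = p
    ...   | no ¬p = contradiction (best (recolour b e i))
              (<⇒≱ (linkage-< a (recolour b e i) (↝-reach (move s e red i)) i (src e) (tgt e)
                (λ p → ¬p (reach-mono avoid (↝-reach s p)))
                (reach-edge e (recolour-new b e i))))
      where
      avoid : colour b i ⊑ without (colour b i) e
      avoid f h = without-intro (colour b i) e f h (λ { refl → be≢i (colour-≡ b e h) })

    module FreeEdges (free? : ∀ e → Dec (Free a e)) where

      ρ : Fin m → Bool
      ρ e = does (free? e)

      ρ-intro : ∀ {e} → Free a e → ρ e ≡ true
      ρ-intro {e} p with free? e
      ... | yes _ = refl
      ... | no ¬p = contradiction p ¬p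

      ρ-elim : ∀ {e} → ρ e ≡ true → Free a e
      ρ-elim {e} h with free? e
      ... | yes p = p

      _∩ρ : (Fin m → Bool) → (Fin m → Bool)
      (F ∩ρ) f = F f ∧ ρ f

      -- Otherwise the last edge leaving the ρ-part at src e would become redundant
      -- after giving e the colour i, hence would be free.
      spanned-free : ∀ {b} → a ↝ b → ∀ e → Redundant b e → ∀ i →
        Reach G (without (colour b i) e ∩ρ) (src e) (tgt e)
      spanned-free {b} s e red i with reachSet {G = G} (without (colour b i) e ∩ρ) (src e)
      ... | W , Wx , reachW , closedW with W (tgt e) in Wy
      ...   | true  = reachW (tgt e) Wy
      ...   | false with last-exit Wx Wy (spanned s e red i)
      ...     | f , Ff , crossf , p , q , Wp , out , ends =
                ⊥-elim (true≢false crossf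
                  (closedW f (∧-intro Ff (ρ-intro (b' , move s e red i , fred)))))
        where
        b' : Fin m → Fin t
        b' = recolour b e i
        inside : (without (colour b i) e ∩ρ) ⊑ without (colour b' i) f
        inside g h = without-intro (colour b' i) f g (recolour-old b e i g (∧-elimˡ h))
          (λ { refl → true≢false crossf (closedW f h) })
        outside : (λ g → without (colour b i) e g ∧ not (crosses G W g)) ⊑ without (colour b' i) f
        outside g h = without-intro (colour b' i) f g (recolour-old b e i g (∧-elimˡ h))
          (λ { refl → true≢false crossf (not-true (∧-elimʳ {without (colour b i) e f} h)) })
        fred : Redundant b' f
        fred = subst (λ c → Reach G (without (colour b' c) f) (src f) (tgt f))
          (sym (colour-≡ b' f (recolour-old b e i f Ff)))
          (ends (reach-trans (reach-sym (reach-mono inside (reachW p Wp)))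
            (reach-trans (reach-edge e (without-intro (colour b' i) f e (recolour-new b e i) (without-≢ (colour b i) e f Ff ∘ sym)))
              (reach-sym (reach-mono outside out)))))

      without-∩ρ : ∀ F e → (without F e ∩ρ) ⊑ (F ∩ρ)
      without-∩ρ F e g h = ∧-intro (without-⊑ F e g (∧-elimˡ h)) (∧-elimʳ {without F e g} h)

      -- Undoes the moves one by one: where a walk uses an edge that a move brought into class `i`,
      -- `spanned-free` offers a detour through free edges of that class before the move. Together
      -- with `ↄ`-free contraction this makes a statement about `b` one about `a`.
      ↝-reach-free : ∀ {b} → a ↝ b → ∀ {i u v} →
        Reach G (colour b i ∩ρ) u v → Reach G (colour a i ∩ρ) u v
      ↝-reach-free stop p = p
      ↝-reach-free (move {b} s e red j) {i} p = ↝-reach-free s (reach-bind step p)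
        where
        step : ∀ f → (colour (recolour b e j) i ∩ρ) f ≡ true →
          Reach G (colour b i ∩ρ) (src f) (tgt f)
        step f h with e Finₚ.≟ f
        ... | yes refl = reach-mono (without-∩ρ (colour b i) e) (spanned-free s e red i)
        ... | no _ = reach-edge f h

      free-spanned : ∀ {u v} → Reach G ρ u v → ∀ i → Reach G (colour a i ∩ρ) u v
      free-spanned p i = reach-bind (λ e h → let b , s , red = ρ-elim h in
        ↝-reach-free s (reach-mono (without-∩ρ (colour b i) e) (spanned-free s e red i))) p

-- Existence of a redundant edge by counting, and the contraction step

nonloop : ∀ {n m} → Graph n m → Fin m → Bool
nonloop G e = not (eqᵇ (proj₁ (G e)) (proj₂ (G e)))

sum-cutSize : ∀ {n m} (G : Graph n m) →
  sumFin (λ v → cutSize G (eqᵇ v)) ≡ count (nonloop G) + count (nonloop G)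
sum-cutSize {n} G = trans (sum-swap (λ v e → ⟦ crosses G (eqᵇ v) e ⟧))
  (trans (sum-cong (λ e → pt (proj₁ (G e)) (proj₂ (G e)))) (sum-+ (⟦_⟧ ∘ nonloop G) (⟦_⟧ ∘ nonloop G)))
  where
  pt : ∀ x y → sumFin (λ v → ⟦ eqᵇ v x xor eqᵇ v y ⟧) ≡ ⟦ not (eqᵇ x y) ⟧ + ⟦ not (eqᵇ x y) ⟧
  pt x y with x Finₚ.≟ y
  ... | yes refl = trans (sum-cong (λ v → cong ⟦_⟧ (xor-same (eqᵇ v x)))) (sum-0 n)
  ... | no x≢y = trans (sum-cong one) (trans (sum-+ (λ v → ⟦ eqᵇ x v ⟧) (λ v → ⟦ eqᵇ y v ⟧))
                   (cong₂ _+_ (count-eqᵇ x) (count-eqᵇ y)))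
    where
    one : ∀ v → ⟦ eqᵇ v x xor eqᵇ v y ⟧ ≡ ⟦ eqᵇ x v ⟧ + ⟦ eqᵇ y v ⟧
    one v rewrite eqᵇ-sym x v | eqᵇ-sym y v with v Finₚ.≟ x | v Finₚ.≟ y
    ... | yes refl | yes q = contradiction q x≢y
    ... | yes _    | no _  = refl
    ... | no _     | yes _ = refl
    ... | no _     | no _  = refl

sum-colour : ∀ {m t} (a : Fin m → Fin t) (F : Fin m → Bool) →
  sumFin (λ i → count (λ e → colour a i e ∧ F e)) ≡ count F
sum-colour {t = t} a F = trans (sum-swap (λ i e → ⟦ colour a i e ∧ F e ⟧)) (sum-cong pt)
  where
  pt : ∀ e → sumFin (λ i → ⟦ eqᵇ (a e) i ∧ F e ⟧) ≡ ⟦ F e ⟧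
  pt e with F e
  ... | true  = trans (sum-cong (λ i → cong ⟦_⟧ (Boolₚ.∧-identityʳ (eqᵇ (a e) i)))) (count-eqᵇ (a e))
  ... | false = trans (sum-cong (λ i → cong ⟦_⟧ (Boolₚ.∧-zeroʳ (eqᵇ (a e) i)))) (sum-0 t)

proper-singleton : ∀ {n} (v : Fin (suc (suc n))) → Proper (eqᵇ v)
proper-singleton zero    = (zero , refl) , (suc zero , refl)
proper-singleton (suc v) = (suc v , eqᵇ-refl (suc v)) , (zero , refl)

module _ {r m t} (G : Graph (suc (suc r)) m) (conn : EdgeConnected G (suc t + suc t))
         (a : Fin m → Fin (suc t)) where
  open Extremal {t = suc t} G

  -- The `r + 2` singleton cuts have at least `2 * (t + 1)` edges each and meet every non-loop
  -- twice, so there are at least `(t + 1) * (r + 2)` non-loops. If none were redundant, they would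
  -- split into `t + 1` forests with at most `r + 1` edges each. A non-loop is wanted because
  -- contracting it loses a vertex.
  ∃-redundant : ∃ λ e → src e ≢ tgt e × Redundant a e
  ∃-redundant with any? (λ e → ¬? (src e Finₚ.≟ tgt e) ×-dec reach? (without (colour a (a e)) e) (src e) (tgt e))
  ... | yes p = p
  ... | no ¬p = contradiction few (<⇒≱ many)
    where
    L : Fin (suc t) → Fin m → Bool
    L i e = colour a i e ∧ nonloop G e

    acyclic : ∀ i → Acyclic G (L i)
    acyclic i e Le p = ¬p (e , x≢y , subst (λ c → Reach G (without (colour a c) e) (src e) (tgt e))
        (sym (colour-≡ a e (∧-elimˡ Le))) (reach-mono sub p))
      where
      x≢y : src e ≢ tgt e
      x≢y q = true≢false (subst (λ y → eqᵇ (src e) y ≡ true) q (eqᵇ-refl (src e)))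
                (not-true (∧-elimʳ {colour a i e} Le))
      sub : without (L i) e ⊑ without (colour a i) e
      sub f h = without-intro (colour a i) e f (∧-elimˡ (without-⊑ (L i) e f h)) (without-≢ (L i) e f h)

    E : ℕ
    E = count (nonloop G)

    many : suc t * suc r < E
    many = *-cancelˡ-< 2 (suc t * suc r) E (begin-strict
      2 * (suc t * suc r)             ≡⟨ *-assoc 2 (suc t) (suc r) ⟨
      2 * suc t * suc r               ≡⟨ *-comm (2 * suc t) (suc r) ⟩
      suc r * (2 * suc t)             <⟨ *-monoˡ-< (2 * suc t) (n<1+n (suc r)) ⟩
      suc (suc r) * (2 * suc t)       ≡⟨ cong (λ x → suc (suc r) * (suc t + x)) (+-identityʳ (suc t)) ⟩
      suc (suc r) * (suc t + suc t)   ≡⟨ sum-const (suc (suc r)) (suc t + suc t) ⟨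
      sumFin {suc (suc r)} (λ _ → suc t + suc t) ≤⟨ sum-mono (λ v → conn (eqᵇ v) (proper-singleton v)) ⟩
      sumFin (λ v → cutSize G (eqᵇ v)) ≡⟨ sum-cutSize G ⟩
      E + E                           ≡⟨ cong (E +_) (+-identityʳ E) ⟨
      2 * E                           ∎)
      where open ≤-Reasoning

    few : E ≤ suc t * suc r
    few = begin
      E                                  ≡⟨ sum-colour a (nonloop G) ⟨
      sumFin (λ i → count (L i))         ≤⟨ sum-mono (λ i → ≤-pred (forest-bound (count (L i)) G (L i) refl (acyclic i) (s≤s z≤n))) ⟩
      sumFin {suc t} (λ _ → suc r)       ≡⟨ sum-const (suc t) (suc r) ⟩
      suc t * suc r                      ∎
      where open ≤-Reasoning

-- A cut of the contracted graph pulls back to a cut of `G` with the same edges; surjectivity keeps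
-- both sides nonempty.
EdgeConnected-relabel : ∀ {n r m l} (G : Graph n m) (ψ : Fin n → Fin r) →
  (∀ x → ∃ λ u → ψ u ≡ x) → EdgeConnected G l → EdgeConnected (relabel ψ G) l
EdgeConnected-relabel G ψ onto conn S ((x , Sx) , (y , Sy)) =
  conn (S ∘ ψ) ((proj₁ (onto x) , trans (cong S (proj₂ (onto x))) Sx)
              , (proj₁ (onto y) , trans (cong S (proj₂ (onto y))) Sy))

module _ {n r m t} {G : Graph n m} (ψ : Fin n → Fin r) (ρ : Fin m → Bool) (a b : Fin m → Fin t)
         (inside : ∀ e → ρ e ≡ true → ψ (proj₁ (G e)) ≡ ψ (proj₂ (G e)))
         (spanned : ∀ {u v} → ψ u ≡ ψ v → ∀ i → Reach G (λ e → colour a i e ∧ ρ e) u v) where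

  merge : Fin m → Fin t
  merge e = if ρ e then a e else b e

  -- An edge of `ρ` on the lifted walk may have lost the colour that `b` gave it, but its ends lie
  -- in one class and are joined by `glue`.
  merge-connected : ∀ i → ConnectedSub (relabel ψ G) (colour b i) → ConnectedSub G (colour merge i)
  merge-connected i conn u v = reach-lift glue step (conn (ψ u) (ψ v)) refl refl
    where
    glue : ∀ {u v} → ψ u ≡ ψ v → Reach G (colour merge i) u v
    glue q = reach-mono (λ e h → subst (λ x → eqᵇ (if x then a e else b e) i ≡ true)
      (sym (∧-elimʳ {colour a i e} h)) (∧-elimˡ h)) (spanned q i)
    step : ∀ e → colour b i e ≡ true → Reach G (colour merge i) (proj₁ (G e)) (proj₂ (G e))
    step e h with ρ e in ρe
    ... | true  = glue (inside e ρe)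
    ... | false = reach-edge e (subst (λ x → eqᵇ (if x then a e else b e) i ≡ true) (sym ρe) h)

-- Nash-Williams' packing: an extremal colouring has free edges, and the free edges are spanned
-- by every colour class, so contracting them leaves a smaller graph. Extremality and freeness are
-- only available under ¬ ¬; this is harmless since equitable colourings can be searched for.
packing : ∀ N {n m} t (G : Graph n m) → n ≤ N → EdgeConnected G (suc t + suc t) →
  ¬ ¬ (Σ[ a ∈ (Fin m → Fin (suc t)) ] ∀ i → ConnectedSub G (colour a i))
packing N {zero}        t G le conn k = k ((λ _ → zero) , λ i ())
packing N {suc zero}    t G le conn k = k ((λ _ → zero) , λ { i zero zero → here })
packing (suc N) {suc (suc r)} t G le conn k =
  maximal linkage _ linkage-bound (λ _ → zero) λ (a , best) →
  ¬¬-decide (Free a) λ free? →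
  let open Maximal a best
      open FreeEdges free?
      e₀ , x≢y , red = ∃-redundant G conn a
      Q = quotient (Reach G ρ) (reach? ρ) here reach-sym reach-trans
      open Quotient Q
      size<n = size< (src e₀) (tgt e₀) x≢y (reach-edge e₀ (ρ-intro (a , stop , red)))
      inside : ∀ e → ρ e ≡ true → class (src e) ≡ class (tgt e)
      inside e ρe = sound (reach-edge e ρe)
      spans : ∀ {u v} → class u ≡ class v → ∀ i → Reach G (colour a i ∩ρ) u v
      spans q = free-spanned (exact q)
  in packing N t (relabel class G) (≤-pred (≤-trans size<n le))
       (EdgeConnected-relabel G class onto conn) λ (b , b-conn) →
     k (merge class ρ a b inside spans
       , λ i → merge-connected class ρ a b inside spans i (b-conn i))
  where
  open Extremal {t = suc t} G

-- Degrees and T-joins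

ends : ∀ {n m} → Graph n m → Fin m → Fin n → ℕ
ends G e z = ⟦ eqᵇ (proj₁ (G e)) z ⟧ + ⟦ eqᵇ (proj₂ (G e)) z ⟧

if-cong : ∀ {b b'} {x : ℕ} → b ≡ b' → (if b then x else 0) ≡ (if b' then x else 0)
if-cong refl = refl

degIn-cong : ∀ {n m} (G : Graph n m) {F F' : Fin m → Bool} → (∀ e → F e ≡ F' e) →
  ∀ z → degIn G F z ≡ degIn G F' z
degIn-cong G h z = sum-cong (λ e → if-cong (h e))

degIn-mono : ∀ {n m} (G : Graph n m) {F F' : Fin m → Bool} → F ⊑ F' → ∀ z → degIn G F z ≤ degIn G F' z
degIn-mono G {F} {F'} h z = sum-mono pt
  where
  pt : ∀ e → (if F e then ends G e z else 0) ≤ (if F' e then ends G e z else 0)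
  pt e with F e in Fe
  ... | false = z≤n
  ... | true rewrite h e Fe = ≤-refl

degIn-∅ : ∀ {n m} (G : Graph n m) z → degIn G (λ _ → false) z ≡ 0
degIn-∅ {m = m} G z = sum-0 m

degIn-single : ∀ {n m} (G : Graph n m) e z → degIn G (eqᵇ e) z ≡ ends G e z
degIn-single G e z = sum-δ e (λ f → ends G f z)

sum-degIn : ∀ {n m} (G : Graph n m) F → sumFin (degIn G F) ≡ count F + count F
sum-degIn {n} G F = trans (sum-swap (λ v e → if F e then ends G e v else 0))
  (trans (sum-cong pt) (sum-+ (⟦_⟧ ∘ F) (⟦_⟧ ∘ F)))
  where
  pt : ∀ e → sumFin (λ v → if F e then ends G e v else 0) ≡ ⟦ F e ⟧ + ⟦ F e ⟧
  pt e with F e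
  ... | false = sum-0 n
  ... | true  = trans (sum-+ (λ v → ⟦ eqᵇ (proj₁ (G e)) v ⟧) (λ v → ⟦ eqᵇ (proj₂ (G e)) v ⟧))
                  (cong₂ _+_ (count-eqᵇ (proj₁ (G e))) (count-eqᵇ (proj₂ (G e))))

odd-degIn-xor : ∀ {n m} (G : Graph n m) (J K : Fin m → Bool) z →
  odd (degIn G (λ e → J e xor K e) z) ≡ odd (degIn G J z) xor odd (degIn G K z)
odd-degIn-xor G J K z = trans (odd-sum (λ e → if J e xor K e then ends G e z else 0))
  (trans (trans (⊕-cong pt) (⊕-xor (λ e → odd (if J e then ends G e z else 0)) (λ e → odd (if K e then ends G e z else 0))))
    (sym (cong₂ _xor_ (odd-sum (λ e → if J e then ends G e z else 0))
                      (odd-sum (λ e → if K e then ends G e z else 0)))))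
  where
  pt : ∀ e → odd (if J e xor K e then ends G e z else 0)
    ≡ odd (if J e then ends G e z else 0) xor odd (if K e then ends G e z else 0)
  pt e with J e | K e
  ... | false | _     = refl
  ... | true  | true  = sym (xor-same (odd (ends G e z)))
  ... | true  | false = sym (Boolₚ.xor-identityʳ (odd (ends G e z)))

odd-degIn-⊕ : ∀ {n m p} (G : Graph n m) (J : Fin p → Fin m → Bool) z →
  odd (degIn G (λ e → ⊕ (λ v → J v e)) z) ≡ ⊕ (λ v → odd (degIn G (J v) z))
odd-degIn-⊕ {p = zero}  G J z = cong odd (degIn-∅ G z)
odd-degIn-⊕ {p = suc p} G J z = trans (odd-degIn-xor G (J zero) (λ e → ⊕ (λ v → J (suc v) e)) z)
  (cong (odd (degIn G (J zero) z) xor_) (odd-degIn-⊕ G (J ∘ suc) z))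

⊕-∃ : ∀ {m} (f : Fin m → Bool) → ⊕ f ≡ true → ∃ λ i → f i ≡ true
⊕-∃ {suc m} f h with f zero in f₀
... | true  = zero , f₀
... | false = let i , p = ⊕-∃ (f ∘ suc) h in suc i , p

⊕-∧ʳ : ∀ {m} (f : Fin m → Bool) b → ⊕ (λ i → f i ∧ b) ≡ ⊕ f ∧ b
⊕-∧ʳ {m} f false = trans (⊕-cong (λ i → Boolₚ.∧-zeroʳ (f i))) (trans (⊕-false m) (sym (Boolₚ.∧-zeroʳ (⊕ f))))
⊕-∧ʳ f true  = trans (⊕-cong (λ i → Boolₚ.∧-identityʳ (f i))) (sym (Boolₚ.∧-identityʳ (⊕ f)))

⊕-select : ∀ {m} (f : Fin m → Bool) j → ⊕ (λ i → f i ∧ eqᵇ i j) ≡ f j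
⊕-select f j = trans (⊕-cong pt) (trans (sym (odd-sum (λ i → if eqᵇ j i then ⟦ f i ⟧ else 0)))
  (trans (cong odd (sum-δ j (⟦_⟧ ∘ f))) (odd-⟦⟧ (f j))))
  where
  pt : ∀ i → f i ∧ eqᵇ i j ≡ odd (if eqᵇ j i then ⟦ f i ⟧ else 0)
  pt i rewrite eqᵇ-sym i j with eqᵇ j i
  ... | true  = trans (Boolₚ.∧-identityʳ (f i)) (sym (odd-⟦⟧ (f i)))
  ... | false = Boolₚ.∧-zeroʳ (f i)

module _ {n m} (G : Graph n m) {F : Fin m → Bool} where

  -- Takes the edges that the walk uses an odd number of times; modulo 2 the degrees telescope, and
  -- only the two ends of the walk remain.
  path-mask : ∀ {u v} → Reach G F u v →
    Σ[ J ∈ (Fin m → Bool) ] J ⊑ F × ∀ z → odd (degIn G J z) ≡ eqᵇ u z xor eqᵇ v z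
  toggle : ∀ {u w} e {x y} → Reach G F u w → F e ≡ true → w ≡ x →
    (∀ z → odd (ends G e z) ≡ eqᵇ x z xor eqᵇ y z) →
    Σ[ J ∈ (Fin m → Bool) ] J ⊑ F × ∀ z → odd (degIn G J z) ≡ eqᵇ u z xor eqᵇ y z

  path-mask {u} here = (λ _ → false) , (λ _ ()) , λ z → trans (cong odd (degIn-∅ G z)) (sym (xor-same (eqᵇ u z)))
  path-mask (fwd e p Fe h) = toggle e {y = proj₂ (G e)} p Fe (sym h) λ z →
    trans (odd-+ ⟦ eqᵇ (proj₁ (G e)) z ⟧ _) (cong₂ _xor_ (odd-⟦⟧ (eqᵇ (proj₁ (G e)) z)) (odd-⟦⟧ (eqᵇ (proj₂ (G e)) z)))
  path-mask (bwd e p Fe h) = toggle e {y = proj₁ (G e)} p Fe (sym h) λ z →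
    trans (odd-+ ⟦ eqᵇ (proj₁ (G e)) z ⟧ _) (trans (cong₂ _xor_ (odd-⟦⟧ (eqᵇ (proj₁ (G e)) z)) (odd-⟦⟧ (eqᵇ (proj₂ (G e)) z)))
      (xor-comm (eqᵇ (proj₁ (G e)) z) _))

  toggle {u} {w} e {x} {y} p Fe refl h with path-mask p
  ... | J , J⊑F , par = (λ f → J f xor eqᵇ e f) , sub , par′
    where
    sub : (λ f → J f xor eqᵇ e f) ⊑ F
    sub f q with J f in Jf
    ... | true  = J⊑F f Jf
    ... | false = subst (λ g → F g ≡ true) (eqᵇ-≡ q) Fe
    par′ : ∀ z → odd (degIn G (λ f → J f xor eqᵇ e f) z) ≡ eqᵇ u z xor eqᵇ y z
    par′ z = begin
      odd (degIn G (λ f → J f xor eqᵇ e f) z)           ≡⟨ odd-degIn-xor G J (eqᵇ e) z ⟩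
      odd (degIn G J z) xor odd (degIn G (eqᵇ e) z)     ≡⟨ cong₂ _xor_ (par z) (trans (cong odd (degIn-single G e z)) (h z)) ⟩
      (eqᵇ u z xor eqᵇ x z) xor (eqᵇ x z xor eqᵇ y z)   ≡⟨ xor-assoc (eqᵇ u z) (eqᵇ x z) _ ⟩
      eqᵇ u z xor (eqᵇ x z xor (eqᵇ x z xor eqᵇ y z))   ≡⟨ cong (eqᵇ u z xor_) (xor-assoc (eqᵇ x z) (eqᵇ x z) _) ⟨
      eqᵇ u z xor ((eqᵇ x z xor eqᵇ x z) xor eqᵇ y z)   ≡⟨ cong (λ b → eqᵇ u z xor (b xor eqᵇ y z)) (xor-same (eqᵇ x z)) ⟩
      eqᵇ u z xor eqᵇ y z                               ∎
      where open ≡-Reasoning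

-- The sum modulo 2 of walks from vertex `zero` to all members of `T`. Each walk contributes its
-- target and `zero`, and the contributions at `zero` cancel because `T` is even.
T-join : ∀ {n m} (G : Graph n m) {F} → ConnectedSub G F → (T : Fin n → Bool) → ⊕ T ≡ false →
  Σ[ J ∈ (Fin m → Bool) ] J ⊑ F × ∀ z → odd (degIn G J z) ≡ T z
T-join {zero} G conn T h = (λ _ → false) , (λ _ ()) , λ ()
T-join {suc n} {m} G {F} conn T h = J , sub , par
  where
  P : ∀ v → Σ[ J ∈ (Fin m → Bool) ] J ⊑ F × ∀ z → odd (degIn G J z) ≡ eqᵇ zero z xor eqᵇ v z
  P v = path-mask G (conn zero v)
  J : Fin m → Bool
  J e = ⊕ (λ v → T v ∧ proj₁ (P v) e)
  sub : J ⊑ F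
  sub e q = let v , p = ⊕-∃ (λ v → T v ∧ proj₁ (P v) e) q in proj₁ (proj₂ (P v)) e (∧-elimʳ {T v} p)
  scale : ∀ v z → odd (degIn G (λ e → T v ∧ proj₁ (P v) e) z) ≡ (T v ∧ eqᵇ zero z) xor (T v ∧ eqᵇ v z)
  scale v z with T v
  ... | true  = proj₂ (proj₂ (P v)) z
  ... | false = cong odd (degIn-∅ G z)
  par : ∀ z → odd (degIn G J z) ≡ T z
  par z = begin
    odd (degIn G J z)                                        ≡⟨ odd-degIn-⊕ G (λ v e → T v ∧ proj₁ (P v) e) z ⟩
    ⊕ (λ v → odd (degIn G (λ e → T v ∧ proj₁ (P v) e) z))    ≡⟨ ⊕-cong (λ v → scale v z) ⟩
    ⊕ (λ v → (T v ∧ eqᵇ zero z) xor (T v ∧ eqᵇ v z))         ≡⟨ ⊕-xor (λ v → T v ∧ eqᵇ zero z) (λ v → T v ∧ eqᵇ v z) ⟩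
    ⊕ (λ v → T v ∧ eqᵇ zero z) xor ⊕ (λ v → T v ∧ eqᵇ v z)   ≡⟨ cong₂ _xor_ (trans (⊕-∧ʳ T (eqᵇ zero z)) (cong (_∧ eqᵇ zero z) h)) (⊕-select T z) ⟩
    T z                                                      ∎
    where open ≡-Reasoning

-- Exchanging two colours along a closed trail

sq : ℕ → ℕ
sq x = x * x

-- An exchange turns the two degrees `p + δ + ε` and `p` into `p + ε` and `p + δ`, so the sum of
-- squares drops by `2 * (δ * ε)`.
sq-identity : ∀ p δ ε → sq (p + ε) + sq (p + δ) + 2 * (δ * ε) ≡ sq (p + δ + ε) + sq p
sq-identity = solve 3 (λ p δ ε →
    (p :+ ε) :* (p :+ ε) :+ (p :+ δ) :* (p :+ δ) :+ con 2 :* (δ :* ε)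
    := (p :+ δ :+ ε) :* (p :+ δ :+ ε) :+ p :* p) refl
  where open +-*-Solver hiding (⟦_⟧)

-- The degrees u, u' of the trail in two colours at a vertex where the colours have degrees
-- d, d': it alternates there, except that once one colour is exhausted it may use the other twice.
record Fair (u u' d d' : ℕ) : Set where
  constructor fair
  field
    parity : odd u ≡ odd u'
    low    : u' < u → u' ≡ d'
    high   : u < u' → u ≡ d

fair-sym : ∀ {u u' d d'} → Fair u u' d d' → Fair u' u d' d
fair-sym (fair p l h) = fair (sym p) h l

fair-0 : ∀ {d d'} → Fair 0 0 d d'
fair-0 = fair refl (λ ()) (λ ())

fair-step : ∀ {u u' d d'} → Fair u u' d d' → suc u ≤ d → u' < d' → Fair (suc u) (suc u') d d'
fair-step (fair p l h) u<d u'<d' = fair (cong not p)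
  (λ lt → contradiction (l (≤-pred lt)) (<⇒≢ u'<d'))
  (λ lt → contradiction (h (≤-pred lt)) (<⇒≢ u<d))

fair-mono : ∀ {u u' d d'} → Fair u u' d d' → suc u ≤ d → u' ≡ d' → Fair (suc (suc u)) u' d d'
fair-mono (fair p l h) u<d u'≡d' = fair (trans (Boolₚ.not-involutive _) p) (λ _ → u'≡d')
  (λ lt → contradiction (h (<-trans (n<1+n _) (<-trans (n<1+n _) lt))) (<⇒≢ u<d))

-- The trail arrives by the end counted in `suc u`. As `u` has the parity of `u' ≡ d'`, hence that
-- of `d`, this arrival cannot have used up its colour.
fair-room : ∀ {u u' d d'} → Fair u u' d d' → odd d ≡ odd d' → suc u ≤ d → u' ≡ d' → suc u < d
fair-room {u} {u'} {d} (fair p l h) pd u<d u'≡d' = ≤∧≢⇒< u<d λ q →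
  not-fix (odd u) (trans (cong odd q) (trans pd (trans (cong odd (sym u'≡d')) (sym p))))
  where
  not-fix : ∀ b → not b ≢ b
  not-fix true ()
  not-fix false ()

-- The less used colour is exhausted, `u' ≡ d'`, so the new degrees lie between the old ones:
-- `sq-identity` with `p = u'`, `δ = u ∸ u'` and `ε = d ∸ u`.
fair-sq-low : ∀ {u u' d d' e e'} → Fair u u' d d' → u ≤ d → u' < u → e + u ≡ d + u' → e' + u' ≡ d' + u →
  sq e + sq e' ≤ sq d + sq d'
fair-sq-low {u} {u'} {e = e} {e'} f u≤d lt h h'
  with refl ← Fair.low f lt | δ , refl ← m≤n⇒∃[o]m+o≡n (<⇒≤ lt) | ε , refl ← m≤n⇒∃[o]m+o≡n u≤d =
  subst₂ (λ x y → sq x + sq y ≤ sq (u' + δ + ε) + sq u') (sym e≡) (sym e'≡)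
    (subst (sq (u' + ε) + sq (u' + δ) ≤_) (sq-identity u' δ ε) (m≤m+n _ _))
  where
  open +-*-Solver hiding (⟦_⟧)
  e≡ : e ≡ u' + ε
  e≡ = +-cancelʳ-≡ (u' + δ) e (u' + ε)
    (trans h (solve 3 (λ p δ ε → p :+ δ :+ ε :+ p := p :+ ε :+ (p :+ δ)) refl u' δ ε))
  e'≡ : e' ≡ u' + δ
  e'≡ = +-cancelʳ-≡ u' e' (u' + δ) (trans h' (+-comm u' (u' + δ)))

fair-sq : ∀ {u u' d d' e e'} → Fair u u' d d' → u ≤ d → u' ≤ d' → e + u ≡ d + u' → e' + u' ≡ d' + u →
  sq e + sq e' ≤ sq d + sq d'
fair-sq {u} {u'} {d} {d'} {e} {e'} f u≤d u'≤d' h h' with <-cmp u u'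
... | tri≈ _ refl _ = ≤-reflexive (cong₂ (λ x y → sq x + sq y) (+-cancelʳ-≡ u e d h) (+-cancelʳ-≡ u e' d' h'))
... | tri> _ _ lt = fair-sq-low f u≤d lt h h'
... | tri< lt _ _ = subst₂ _≤_ (+-comm (sq e') (sq e)) (+-comm (sq d') (sq d))
      (fair-sq-low (fair-sym f) u'≤d' lt h' h)

-- Two ends move from the larger degree to the smaller one: `sq-identity` with `δ = 2` and
-- `ε = d ∸ d' ∸ 2`, which a gap of three makes positive.
gap-sq : ∀ {u u' d d' e e'} → u ≡ 2 + u' → 3 + d' ≤ d → e + u ≡ d + u' → e' + u' ≡ d' + u →
  sq e + sq e' < sq d + sq d'
gap-sq {u' = u'} {d' = d'} {e} {e'} refl gap h h' with t , refl ← m≤n⇒∃[o]m+o≡n gap =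
  subst₂ (λ x y → sq x + sq y < sq (3 + d' + t) + sq d') (sym e≡) (sym e'≡)
    (subst (sq (d' + suc t) + sq (d' + 2) <_) rearranged
      (m<m+n _ (s≤s z≤n)))
  where
  open +-*-Solver hiding (⟦_⟧)
  rearranged : sq (d' + suc t) + sq (d' + 2) + 2 * (2 * suc t) ≡ sq (3 + d' + t) + sq d'
  rearranged = trans (sq-identity d' 2 (suc t))
    (cong (λ x → sq x + sq d') (solve 2 (λ p t → p :+ con 2 :+ (con 1 :+ t) := con 3 :+ p :+ t) refl d' t))
  e≡ : e ≡ d' + suc t
  e≡ = +-cancelʳ-≡ (2 + u') e (d' + suc t) (trans h
    (solve 3 (λ p t w → con 3 :+ p :+ t :+ w := p :+ (con 1 :+ t) :+ (con 2 :+ w)) refl d' t u'))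
  e'≡ : e' ≡ d' + 2
  e'≡ = +-cancelʳ-≡ u' e' (d' + 2) (trans h' (sym (+-assoc d' 2 u')))

sum-two : ∀ {k} (f g : Fin k → ℕ) i j → (∀ l → l ≢ i → l ≢ j → f l ≡ g l) →
  i ≢ j → sumFin f + (g i + g j) ≡ sumFin g + (f i + f j)
sum-two f g i j same i≢j = trans (sym (expand f g)) (trans (sum-cong pt) (expand g f))
  where
  at : Fin _ → ℕ → ℕ → ℕ
  at l x y = x + ((if eqᵇ i l then y else 0) + (if eqᵇ j l then y else 0))
  expand : ∀ (f g : Fin _ → ℕ) → sumFin (λ l → at l (f l) (g l)) ≡ sumFin f + (g i + g j)
  expand f g = trans (sum-+ f (λ l → (if eqᵇ i l then g l else 0) + (if eqᵇ j l then g l else 0)))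
    (cong (sumFin f +_) (trans (sum-+ (λ l → if eqᵇ i l then g l else 0) (λ l → if eqᵇ j l then g l else 0))
      (cong₂ _+_ (sum-δ i g) (sum-δ j g))))
  pt : ∀ l → at l (f l) (g l) ≡ at l (g l) (f l)
  pt l with i Finₚ.≟ l | j Finₚ.≟ l
  ... | yes refl | yes refl = contradiction refl i≢j
  ... | yes _ | no _  = trans (cong (f l +_) (+-identityʳ (g l)))
                          (trans (+-comm (f l) (g l)) (cong (g l +_) (sym (+-identityʳ (f l)))))
  ... | no _  | yes _ = +-comm (f l) (g l)
  ... | no i≢l | no j≢l = cong (_+ 0) (same l (i≢l ∘ sym) (j≢l ∘ sym))

module Trail {N M k} (H : Graph N M) (c : Fin M → Fin k) (i j : Fin k) (i≢j : i ≢ j)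
  (par : ∀ z → odd (degIn H (colour c i) z) ≡ odd (degIn H (colour c j) z))
  (v : Fin N) (gap : degIn H (colour c j) v < degIn H (colour c i) v) where

  deg′ : Fin k → Fin N → ℕ
  deg′ l = degIn H (colour c l)

  used : (Fin M → Bool) → Fin k → Fin N → ℕ
  used D l = degIn H (λ e → D e ∧ colour c l e)

  used≤ : ∀ D l z → used D l z ≤ deg′ l z
  used≤ D l = degIn-mono H (λ e → ∧-elimʳ {D e})

  extend : (Fin M → Bool) → Fin M → Fin M → Bool
  extend D f e = D e ∨ eqᵇ f e

  extend-< : ∀ D f → D f ≡ false → count (not ∘ extend D f) < count (not ∘ D)
  extend-< D f h = sum-mono-< le f lt
    where
    le : ∀ e → ⟦ not (D e ∨ eqᵇ f e) ⟧ ≤ ⟦ not (D e) ⟧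
    le e with D e
    ... | true = z≤n
    ... | false with eqᵇ f e
    ...   | true  = z≤n
    ...   | false = ≤-refl
    lt : ⟦ not (D f ∨ eqᵇ f f) ⟧ < ⟦ not (D f) ⟧
    lt rewrite h | eqᵇ-refl f = z<s

  used-same : ∀ D f l → D f ≡ false → c f ≡ l → ∀ z → used (extend D f) l z ≡ ends H f z + used D l z
  used-same D f l Df refl z = trans (sum-cong pt)
    (trans (sum-+ (λ e → if eqᵇ f e then ends H e z else 0) (λ e → if D e ∧ colour c l e then ends H e z else 0))
           (cong (_+ used D l z) (sum-δ f (λ e → ends H e z))))
    where
    pt : ∀ e → (if (D e ∨ eqᵇ f e) ∧ colour c l e then ends H e z else 0)
      ≡ (if eqᵇ f e then ends H e z else 0) + (if D e ∧ colour c l e then ends H e z else 0)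
    pt e with f Finₚ.≟ e
    ... | yes refl rewrite Df | eqᵇ-refl (c f) = sym (+-identityʳ _)
    ... | no _ rewrite Boolₚ.∨-identityʳ (D e) = refl

  used-other : ∀ D f l → c f ≢ l → ∀ z → used (extend D f) l z ≡ used D l z
  used-other D f l h = degIn-cong H pt
    where
    pt : ∀ e → (D e ∨ eqᵇ f e) ∧ colour c l e ≡ D e ∧ colour c l e
    pt e with f Finₚ.≟ e
    ... | yes refl rewrite eqᵇ-≢ h = trans (Boolₚ.∧-zeroʳ _) (sym (Boolₚ.∧-zeroʳ _))
    ... | no _ rewrite Boolₚ.∨-identityʳ (D e) = refl

  -- `join` describes the ends through their degree contributions, which covers both orientations as
  -- well as loops, where `target` is `x` itself.
  record Exit (D : Fin M → Bool) (l : Fin k) (x : Fin N) : Set where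
    field
      edge   : Fin M
      fresh  : D edge ≡ false
      hue    : c edge ≡ l
      target : Fin N
      join   : ∀ z → ends H edge z ≡ ⟦ eqᵇ x z ⟧ + ⟦ eqᵇ target z ⟧

  exit : ∀ D l x → used D l x < deg′ l x → Exit D l x
  exit D l x lt with sum-<-∃ (λ e → if D e ∧ colour c l e then ends H e x else 0)
                             (λ e → if colour c l e then ends H e x else 0) lt
  ... | f , lt′ with D f in Df | c f Finₚ.≟ l
  ...   | true  | yes _ = contradiction lt′ (<-irrefl refl)
  ...   | true  | no _  = contradiction lt′ (<-irrefl refl)
  ...   | false | yes cf with proj₁ (H f) Finₚ.≟ x | proj₂ (H f) Finₚ.≟ x
  ...     | yes refl | _ = record { edge = f ; fresh = Df ; hue = cf ; target = proj₂ (H f) ; join = λ z → refl }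
  ...     | no _ | yes refl = record { edge = f ; fresh = Df ; hue = cf ; target = proj₁ (H f)
                                     ; join = λ z → +-comm ⟦ eqᵇ (proj₁ (H f)) z ⟧ _ }

  -- A trail that left v through an edge of colour i and has just reached x through an edge of
  -- colour p; before is the degree in colour p without this last arrival.
  record At (D : Fin M → Bool) (x : Fin N) (p q : Fin k) : Set where
    field
      before : Fin N → ℕ
      used-p : ∀ z → used D p z ≡ ⟦ eqᵇ x z ⟧ + before z
      fairly : ∀ z → z ≢ v → Fair (before z) (used D q z) (deg′ p z) (deg′ q z)
      home   : (p ≡ i × q ≡ j × before v ≡ suc (used D q v))
             ⊎ (p ≡ j × q ≡ i × used D q v ≡ suc (before v))

    colours-≢ : p ≢ q
    colours-≢ with home
    ... | inj₁ (refl , refl , _) = i≢j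
    ... | inj₂ (refl , refl , _) = i≢j ∘ sym

    same-parity : ∀ z → odd (deg′ p z) ≡ odd (deg′ q z)
    same-parity z with home
    ... | inj₁ (refl , refl , _) = par z
    ... | inj₂ (refl , refl , _) = sym (par z)

    before< : suc (before x) ≤ deg′ p x
    before< = subst (_≤ deg′ p x) (trans (used-p x) (cong (λ b → ⟦ b ⟧ + before x) (eqᵇ-refl x))) (used≤ D p x)

  -- The 2 in `home` comes from the first departure from `v` and the final arrival, both of colour
  -- `i`; in between, each arrival by `j` is followed by a departure by `i`.
  record Circuit : Set where
    field
      mask   : Fin M → Bool
      fairly : ∀ z → z ≢ v → Fair (used mask i z) (used mask j z) (deg′ i z) (deg′ j z)
      home   : used mask i v ≡ 2 + used mask j v

  shuffle : ∀ a b w → (a + b) + w ≡ b + (a + w)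
  shuffle a b w = trans (cong (_+ w) (+-comm a b)) (+-assoc b a w)

  module _ {D : Fin M → Bool} {x p q} (s : At D x p q) where
    open At s

    alternate : used D q x < deg′ q x → (E : Exit D q x) → At (extend D (Exit.edge E)) (Exit.target E) q p
    alternate room E = record
      { before = λ z → ⟦ eqᵇ x z ⟧ + used D q z
      ; used-p = λ z → trans (used-same D edge q fresh hue z)
          (trans (cong (_+ used D q z) (join z)) (shuffle ⟦ eqᵇ x z ⟧ ⟦ eqᵇ target z ⟧ (used D q z)))
      ; fairly = λ z z≢v → subst (λ w → Fair (⟦ eqᵇ x z ⟧ + used D q z) w (deg′ q z) (deg′ p z))
          (sym (trans (other z) (used-p z))) (step z z≢v)
      ; home = home′ home }
      where
      open Exit E
      other : ∀ z → used (extend D edge) p z ≡ used D p z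
      other = used-other D edge p (λ h → colours-≢ (trans (sym h) hue))
      step : ∀ z → z ≢ v → Fair (⟦ eqᵇ x z ⟧ + used D q z) (⟦ eqᵇ x z ⟧ + before z) (deg′ q z) (deg′ p z)
      step z z≢v with x Finₚ.≟ z
      ... | yes refl = fair-sym (fair-step (fairly z z≢v) before< room)
      ... | no _     = fair-sym (fairly z z≢v)
      home′ : (p ≡ i × q ≡ j × before v ≡ suc (used D q v)) ⊎ (p ≡ j × q ≡ i × used D q v ≡ suc (before v)) →
              (q ≡ i × p ≡ j × ⟦ eqᵇ x v ⟧ + used D q v ≡ suc (used (extend D edge) p v))
            ⊎ (q ≡ j × p ≡ i × used (extend D edge) p v ≡ suc (⟦ eqᵇ x v ⟧ + used D q v))
      home′ (inj₁ (a , b , h)) = inj₂ (b , a , trans (other v) (trans (used-p v)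
        (trans (cong (⟦ eqᵇ x v ⟧ +_) h) (+-suc ⟦ eqᵇ x v ⟧ _))))
      home′ (inj₂ (a , b , h)) = inj₁ (b , a , trans (cong (⟦ eqᵇ x v ⟧ +_) h)
        (trans (+-suc ⟦ eqᵇ x v ⟧ _) (cong suc (sym (trans (other v) (used-p v))))))

    repeat : x ≢ v → used D q x ≡ deg′ q x → (E : Exit D p x) → At (extend D (Exit.edge E)) (Exit.target E) p q
    repeat x≢v full E = record
      { before = λ z → ⟦ eqᵇ x z ⟧ + used D p z
      ; used-p = λ z → trans (used-same D edge p fresh hue z)
          (trans (cong (_+ used D p z) (join z)) (shuffle ⟦ eqᵇ x z ⟧ ⟦ eqᵇ target z ⟧ (used D p z)))
      ; fairly = λ z z≢v → subst₂ (λ u w → Fair (⟦ eqᵇ x z ⟧ + u) w (deg′ p z) (deg′ q z))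
          (sym (used-p z)) (sym (other z)) (step z z≢v)
      ; home = home′ home }
      where
      open Exit E
      other : ∀ z → used (extend D edge) q z ≡ used D q z
      other = used-other D edge q (λ h → colours-≢ (trans (sym hue) h))
      step : ∀ z → z ≢ v → Fair (⟦ eqᵇ x z ⟧ + (⟦ eqᵇ x z ⟧ + before z)) (used D q z) (deg′ p z) (deg′ q z)
      step z z≢v with x Finₚ.≟ z
      ... | yes refl = fair-mono (fairly z z≢v) before< full
      ... | no _     = fairly z z≢v
      before-v : ⟦ eqᵇ x v ⟧ + used D p v ≡ before v
      before-v = trans (cong (⟦ eqᵇ x v ⟧ +_) (used-p v))
        (cong (λ b → ⟦ b ⟧ + (⟦ b ⟧ + before v)) (eqᵇ-≢ x≢v))
      home′ : (p ≡ i × q ≡ j × before v ≡ suc (used D q v)) ⊎ (p ≡ j × q ≡ i × used D q v ≡ suc (before v)) →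
              (p ≡ i × q ≡ j × ⟦ eqᵇ x v ⟧ + used D p v ≡ suc (used (extend D edge) q v))
            ⊎ (p ≡ j × q ≡ i × used (extend D edge) q v ≡ suc (⟦ eqᵇ x v ⟧ + used D p v))
      home′ (inj₁ (a , b , h)) = inj₁ (a , b , trans before-v (trans h (cong suc (sym (other v)))))
      home′ (inj₂ (a , b , h)) = inj₂ (a , b , trans (other v) (trans h (cong suc (sym before-v))))

  -- The trail grows greedily and never gets stuck. Away from `v` it changes colour if a fresh edge
  -- allows it; otherwise parity leaves another edge of the arrival colour. At `v` it stops after
  -- arriving by `i`, and after arriving by `j` the gap lets it continue.
  walk : ∀ fuel {D x p q} → count (not ∘ D) ≤ fuel → At D x p q → Circuit
  take : ∀ fuel {D x l p q} → count (not ∘ D) ≤ fuel → (E : Exit D l x) →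
    At (extend D (Exit.edge E)) (Exit.target E) p q → Circuit
  take zero {D} b E s = contradiction (extend-< D (Exit.edge E) (Exit.fresh E)) (≤⇒≯ (≤-trans b z≤n))
  take (suc fuel) {D} b E s = walk fuel (≤-pred (≤-trans (extend-< D (Exit.edge E) (Exit.fresh E)) b)) s
  walk fuel {D} {x} {p} {q} b s with x Finₚ.≟ v
  ... | no x≢v with used D q x <? deg′ q x
  ...   | yes room = let E = exit D q x room in take fuel b E (alternate s room E)
  ...   | no full = let E = exit D p x room in take fuel b E (repeat s x≢v full′ E)
    where
    open At s
    full′ : used D q x ≡ deg′ q x
    full′ = ≤-antisym (used≤ D q x) (≮⇒≥ full)
    room : used D p x < deg′ p x
    room = subst (_< deg′ p x) (sym (trans (used-p x) (cong (λ b → ⟦ b ⟧ + before x) (eqᵇ-refl x))))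
      (fair-room (fairly x x≢v) (same-parity x) before< full′)
  walk fuel {D} {x} {p} {q} b s | yes refl with At.home s
  ...   | inj₁ (refl , refl , h) = record { mask = D ; fairly = fairly′
            ; home = trans (used-p v) (trans (cong (λ b → ⟦ b ⟧ + before v) (eqᵇ-refl v)) (cong suc h)) }
    where
    open At s
    fairly′ : ∀ z → z ≢ v → Fair (used D p z) (used D q z) (deg′ p z) (deg′ q z)
    fairly′ z z≢v = subst (λ w → Fair w (used D q z) (deg′ p z) (deg′ q z))
      (sym (trans (used-p z) (cong (λ b → ⟦ b ⟧ + before z) (eqᵇ-≢ (z≢v ∘ sym))))) (fairly z z≢v)
  ...   | inj₂ (refl , refl , h) = let E = exit D q v room in take fuel b E (alternate s room E)
    where
    open At s
    -- At this moment `v` has as many used ends of colour `i` as of colour `j`, and the latter are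
    -- at most `deg′ j v`, which is less than `deg′ i v`.
    room : used D q v < deg′ q v
    room = ≤-<-trans (subst (_≤ deg′ p v) (trans (used-p v)
      (trans (cong (λ b → ⟦ b ⟧ + before v) (eqᵇ-refl v)) (sym h))) (used≤ D p v)) gap

  circuit : Circuit
  circuit = take _ ≤-refl E record
    { before = λ z → ⟦ eqᵇ v z ⟧
    ; used-p = λ z → trans (used-same ∅ edge i fresh hue z) (trans (cong₂ _+_ (join z) (used-∅ i z))
        (trans (+-identityʳ _) (+-comm ⟦ eqᵇ v z ⟧ _)))
    ; fairly = λ z z≢v → subst₂ (λ u w → Fair u w (deg′ i z) (deg′ j z))
        (sym (cong ⟦_⟧ (eqᵇ-≢ (z≢v ∘ sym)))) (sym (other z)) fair-0
    ; home = inj₁ (refl , refl , trans (cong ⟦_⟧ (eqᵇ-refl v)) (cong suc (sym (other v)))) }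
    where
    ∅ : Fin M → Bool
    ∅ _ = false
    used-∅ : ∀ l z → used ∅ l z ≡ 0
    used-∅ l = degIn-∅ H
    E : Exit ∅ i v
    E = exit ∅ i v (subst (_< deg′ i v) (sym (used-∅ i v)) (≤-<-trans z≤n gap))
    open Exit E
    other : ∀ z → used (extend ∅ edge) j z ≡ 0
    other z = trans (used-other ∅ edge j (λ h → i≢j (trans (sym hue) h)) z) (used-∅ j z)

xor-cancelʳ : ∀ a b c → a xor c ≡ b xor c → a ≡ b
xor-cancelʳ a b c h = trans (sym (undo a)) (trans (cong (_xor c) h) (undo b))
  where
  undo : ∀ x → (x xor c) xor c ≡ x
  undo x = trans (xor-assoc x c c) (trans (cong (x xor_) (xor-same c)) (Boolₚ.xor-identityʳ x))

odd-exchange : ∀ e u d u' → e + u ≡ d + u' → odd u ≡ odd u' → odd e ≡ odd d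
odd-exchange e u d u' h p = xor-cancelʳ (odd e) (odd d) (odd u) (begin
  odd e xor odd u    ≡⟨ odd-+ e u ⟨
  odd (e + u)        ≡⟨ cong odd h ⟩
  odd (d + u')       ≡⟨ odd-+ d u' ⟩
  odd d xor odd u'   ≡⟨ cong (odd d xor_) p ⟨
  odd d xor odd u    ∎)
  where open ≡-Reasoning

transpose : ∀ {k} → Fin k → Fin k → Fin k → Fin k
transpose i j l = if eqᵇ l i then j else if eqᵇ l j then i else l

module _ {k} {i j : Fin k} (i≢j : i ≢ j) where

  transpose-i : ∀ l → eqᵇ (transpose i j l) i ≡ eqᵇ l j
  transpose-i l with l Finₚ.≟ i | l Finₚ.≟ j
  ... | yes refl | yes refl = contradiction refl i≢j
  ... | yes _ | no _   = eqᵇ-≢ (i≢j ∘ sym)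
  ... | no _  | yes _  = eqᵇ-refl i
  ... | no l≢i | no _  = eqᵇ-≢ l≢i

  transpose-j : ∀ l → eqᵇ (transpose i j l) j ≡ eqᵇ l i
  transpose-j l with l Finₚ.≟ i | l Finₚ.≟ j
  ... | yes _ | _      = eqᵇ-refl j
  ... | no _  | yes _  = eqᵇ-≢ i≢j
  ... | no _ | no l≢j  = eqᵇ-≢ l≢j

  transpose-other : ∀ l l' → l' ≢ i → l' ≢ j → eqᵇ (transpose i j l) l' ≡ eqᵇ l l'
  transpose-other l l' a b with l Finₚ.≟ i | l Finₚ.≟ j
  ... | yes refl | _       = trans (eqᵇ-≢ (b ∘ sym)) (sym (eqᵇ-≢ (a ∘ sym)))
  ... | no _ | yes refl    = trans (eqᵇ-≢ (a ∘ sym)) (sym (eqᵇ-≢ (b ∘ sym)))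
  ... | no _ | no _        = refl

-- Balancing all colours by repeated exchanges

module Balance {N M k : ℕ} (H : Graph N M) where

  deg′ : (Fin M → Fin k) → Fin k → Fin N → ℕ
  deg′ c l = degIn H (colour c l)

  spread : (Fin M → Fin k) → ℕ
  spread c = sumFin λ z → sumFin λ l → sq (deg′ c l z)

  module Switch (c : Fin M → Fin k) {i j : Fin k} (i≢j : i ≢ j) (D : Fin M → Bool) where

    c′ : Fin M → Fin k
    c′ e = if D e then transpose i j (c e) else c e

    exchange : ∀ p q → (∀ l → eqᵇ (transpose i j l) p ≡ eqᵇ l q) → ∀ z →
      deg′ c′ p z + degIn H (λ e → D e ∧ colour c p e) z ≡ deg′ c p z + degIn H (λ e → D e ∧ colour c q e) z
    exchange p q h z = trans (sym (sum-+ (λ e → at (colour c′ p) e) (λ e → at (λ e → D e ∧ colour c p e) e)))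
      (trans (sum-cong pt) (sum-+ (λ e → at (colour c p) e) (λ e → at (λ e → D e ∧ colour c q e) e)))
      where
      at : (Fin M → Bool) → Fin M → ℕ
      at F e = if F e then ends H e z else 0
      pt : ∀ e → at (colour c′ p) e + at (λ e → D e ∧ colour c p e) e
        ≡ at (colour c p) e + at (λ e → D e ∧ colour c q e) e
      pt e with D e
      ... | false = refl
      ... | true rewrite h (c e) = +-comm (if eqᵇ (c e) q then ends H e z else 0) _

    others : ∀ l → l ≢ i → l ≢ j → ∀ z → deg′ c′ l z ≡ deg′ c l z
    others l a b = degIn-cong H pt
      where
      pt : ∀ e → eqᵇ (c′ e) l ≡ eqᵇ (c e) l
      pt e with D e
      ... | true  = transpose-other i≢j (c e) l a b
      ... | false = refl

  module Improve (c : Fin M → Fin k) (par : ∀ z l l' → odd (deg′ c l z) ≡ odd (deg′ c l' z))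
    {i j : Fin k} (i≢j : i ≢ j) (v : Fin N) (gap : 3 + deg′ c j v ≤ deg′ c i v)
    (gap′ : deg′ c j v < deg′ c i v)
    (C : Trail.Circuit H c i j i≢j (λ z → par z i j) v gap′) where
    open Trail H c i j i≢j (λ z → par z i j) v gap′ using (used; used≤; module Circuit)
    open Circuit C
    open Switch c i≢j mask
    ex-i : ∀ z → deg′ c′ i z + used mask i z ≡ deg′ c i z + used mask j z
    ex-i = exchange i j (transpose-i i≢j)
    ex-j : ∀ z → deg′ c′ j z + used mask j z ≡ deg′ c j z + used mask i z
    ex-j = exchange j i (transpose-j i≢j)
    used-parity : ∀ z → odd (used mask i z) ≡ odd (used mask j z)
    used-parity z with z Finₚ.≟ v
    ... | yes refl = trans (cong odd home) (Boolₚ.not-involutive _)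
    ... | no z≢v   = Fair.parity (fairly z z≢v)
    parity : ∀ l z → odd (deg′ c′ l z) ≡ odd (deg′ c l z)
    parity l z with l Finₚ.≟ i | l Finₚ.≟ j
    ... | yes refl | _ = odd-exchange (deg′ c′ l z) (used mask i z) (deg′ c l z) (used mask j z) (ex-i z) (used-parity z)
    ... | no _ | yes refl = odd-exchange (deg′ c′ l z) (used mask j z) (deg′ c l z) (used mask i z) (ex-j z) (sym (used-parity z))
    ... | no a | no b = cong odd (others l a b z)
    two : ∀ z → let f = λ l → sq (deg′ c′ l z) ; g = λ l → sq (deg′ c l z) in
      sumFin f + (g i + g j) ≡ sumFin g + (f i + f j)
    two z = sum-two (λ l → sq (deg′ c′ l z)) (λ l → sq (deg′ c l z)) i j (λ l a b → cong sq (others l a b z)) i≢j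
    lt : sumFin (λ l → sq (deg′ c′ l v)) < sumFin (λ l → sq (deg′ c l v))
    lt = +-cancelʳ-< (sq (deg′ c i v) + sq (deg′ c j v)) _ _
      (subst (_< sumFin (λ l → sq (deg′ c l v)) + (sq (deg′ c i v) + sq (deg′ c j v))) (sym (two v))
        (+-monoʳ-< (sumFin (λ l → sq (deg′ c l v))) (gap-sq home gap (ex-i v) (ex-j v))))
    le : ∀ z → sumFin (λ l → sq (deg′ c′ l z)) ≤ sumFin (λ l → sq (deg′ c l z))
    le z with z Finₚ.≟ v
    ... | yes refl = <⇒≤ lt
    ... | no z≢v = +-cancelʳ-≤ (sq (deg′ c i z) + sq (deg′ c j z)) _ _
      (subst (_≤ sumFin (λ l → sq (deg′ c l z)) + (sq (deg′ c i z) + sq (deg′ c j z))) (sym (two z))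
        (+-monoʳ-≤ (sumFin (λ l → sq (deg′ c l z)))
          (fair-sq (fairly z z≢v) (used≤ mask i z) (used≤ mask j z) (ex-i z) (ex-j z))))

    improved : Σ[ c' ∈ (Fin M → Fin k) ] (∀ l z → odd (deg′ c' l z) ≡ odd (deg′ c l z)) × spread c' < spread c
    improved = c′ , parity , sum-mono-< le v lt

  improve : ∀ c → (∀ z l l' → odd (deg′ c l z) ≡ odd (deg′ c l' z)) →
    ∀ v i j → 3 + deg′ c j v ≤ deg′ c i v →
    Σ[ c' ∈ (Fin M → Fin k) ] (∀ l z → odd (deg′ c' l z) ≡ odd (deg′ c l z)) × spread c' < spread c
  improve c par v i j gap = Improve.improved c par i≢j v gap gap′
    (Trail.circuit H c i j i≢j (λ z → par z i j) v gap′)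
    where
    i≢j : i ≢ j
    i≢j refl = contradiction gap (<⇒≱ (m≤n+m (suc (deg′ c i v)) 2))
    gap′ : deg′ c j v < deg′ c i v
    gap′ = ≤-trans (m≤n+m (suc (deg′ c j v)) 2) gap

  -- Every exchange lowers the sum of squares `spread`, so the process ends. A difference of two is
  -- left alone: moving two ends would merely swap the two degrees.
  balance : ∀ c → (∀ z l l' → odd (deg′ c l z) ≡ odd (deg′ c l' z)) →
    Σ[ c' ∈ (Fin M → Fin k) ] (∀ l z → odd (deg′ c' l z) ≡ odd (deg′ c l z))
      × (∀ z l l' → deg′ c' l z ≤ 2 + deg′ c' l' z)
  balance c = go (suc (spread c)) c ≤-refl
    where
    go : ∀ fuel c → spread c < fuel → (∀ z l l' → odd (deg′ c l z) ≡ odd (deg′ c l' z)) →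
      Σ[ c' ∈ (Fin M → Fin k) ] (∀ l z → odd (deg′ c' l z) ≡ odd (deg′ c l z))
        × (∀ z l l' → deg′ c' l z ≤ 2 + deg′ c' l' z)
    go (suc fuel) c b par with any? (λ z → any? (λ i → any? (λ j → 3 + deg′ c j z ≤? deg′ c i z)))
    ... | no ¬p = c , (λ l z → refl) , λ z l l' → ≤-pred (≰⇒> (λ q → ¬p (z , l , l' , q)))
    ... | yes (v , i , j , gap) =
      let c₁ , par₁ , lt = improve c par v i j gap
          c₂ , par₂ , bal = go fuel c₁ (<-≤-trans lt (≤-pred b))
            (λ z l l' → trans (par₁ l z) (trans (par z l l') (sym (par₁ l' z))))
      in c₂ , (λ l z → trans (par₂ l z) (par₁ l z)) , bal

-- The colour sets S(v)

module RoundRobin (κ : ℕ) where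

  k : ℕ
  k = suc κ

  toℕ-mod : ∀ B → toℕ (B mod k) ≡ B % k
  toℕ-mod B = Finₚ.toℕ-fromℕ< (m%n<n B k)

  -- The number of t < B congruent to i modulo k.
  cnt : ℕ → Fin k → ℕ
  cnt zero    i = 0
  cnt (suc B) i = cnt B i + ⟦ eqᵇ (B mod k) i ⟧

  sum-cnt : ∀ B → sumFin (cnt B) ≡ B
  sum-cnt zero    = sum-0 k
  sum-cnt (suc B) = trans (sum-+ (cnt B) (λ i → ⟦ eqᵇ (B mod k) i ⟧))
    (trans (cong₂ _+_ (sum-cnt B) (count-eqᵇ (B mod k))) (+-comm B 1))

  cnt-initial : ∀ j i → j ≤ k → (j ≤ toℕ i → cnt j i ≡ 0) × (toℕ i < j → cnt j i ≡ 1)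
  cnt-initial zero    i le = (λ _ → refl) , λ ()
  cnt-initial (suc j) i le = absent , present
    where
    IH = cnt-initial j i (<⇒≤ le)
    j≡ : toℕ (j mod k) ≡ j
    j≡ = trans (toℕ-mod j) (m<n⇒m%n≡m le)
    miss : toℕ i ≢ j → ⟦ eqᵇ (j mod k) i ⟧ ≡ 0
    miss h = cong ⟦_⟧ (eqᵇ-≢ (λ p → h (trans (cong toℕ (sym p)) j≡)))
    absent : suc j ≤ toℕ i → cnt (suc j) i ≡ 0
    absent lt = cong₂ _+_ (proj₁ IH (<⇒≤ lt)) (miss (<⇒≢ lt ∘ sym))
    present : toℕ i < suc j → cnt (suc j) i ≡ 1
    present lt with toℕ i ≟ j
    ... | no h = cong₂ _+_ (proj₂ IH (≤∧≢⇒< (≤-pred lt) h)) (miss h)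
    ... | yes h = cong₂ (λ x y → x + ⟦ y ⟧) (proj₁ IH (≤-reflexive (sym h)))
        (trans (cong (λ x → eqᵇ x i) (Finₚ.toℕ-injective (trans j≡ (sym h)))) (eqᵇ-refl i))

  cnt-period : ∀ B i → cnt (B + k) i ≡ suc (cnt B i)
  cnt-period zero i = proj₂ (cnt-initial k i ≤-refl) (Finₚ.toℕ<n i)
  cnt-period (suc B) i = cong₂ (λ x y → x + ⟦ eqᵇ y i ⟧) (cnt-period B i)
    (Finₚ.toℕ-injective (trans (toℕ-mod (B + k)) (trans ([m+n]%n≡m%n B k) (sym (toℕ-mod B)))))

  cnt-periods : ∀ w B i → cnt (B + w * k) i ≡ cnt B i + w
  cnt-periods zero    B i = trans (cong (λ x → cnt x i) (+-identityʳ B)) (sym (+-identityʳ (cnt B i)))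
  cnt-periods (suc w) B i = begin
    cnt (B + (k + w * k)) i ≡⟨ cong (λ x → cnt (B + x) i) (+-comm k (w * k)) ⟩
    cnt (B + (w * k + k)) i ≡⟨ cong (λ x → cnt x i) (+-assoc B (w * k) k) ⟨
    cnt (B + w * k + k) i   ≡⟨ cnt-period (B + w * k) i ⟩
    suc (cnt (B + w * k) i) ≡⟨ cong suc (cnt-periods w B i) ⟩
    suc (cnt B i + w)       ≡⟨ +-suc (cnt B i) w ⟨
    cnt B i + suc w         ∎
    where open ≡-Reasoning

  cnt-mono : ∀ B b i → cnt B i ≤ cnt (B + b) i
  cnt-mono B zero    i = ≤-reflexive (cong (λ x → cnt x i) (sym (+-identityʳ B)))
  cnt-mono B (suc b) i = ≤-trans (cnt-mono B b i)
    (≤-trans (m≤m+n _ _) (≤-reflexive (cong (λ x → cnt x i) (sym (+-suc B b)))))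

  positive : ℕ → Bool
  positive zero    = false
  positive (suc _) = true

  -- For `b ≤ k` these are the `b` colours that follow position `B` in cyclic order; the two counts
  -- then differ by at most one.
  row : ℕ → ℕ → Fin k → Bool
  row B b i = positive (cnt (B + b) i ∸ cnt B i)

  row-cnt : ∀ B b → b ≤ k → ∀ i → cnt B i + ⟦ row B b i ⟧ ≡ cnt (B + b) i
  row-cnt B b b≤k i with cnt (B + b) i ∸ cnt B i in eq
  ... | zero  = trans (+-identityʳ _) (≤-antisym (cnt-mono B b i) (m∸n≡0⇒m≤n eq))
  ... | suc _ = ≤-antisym (≤-trans (≤-reflexive (+-comm _ 1)) (gap eq)) (begin
      cnt (B + b) i             ≤⟨ cnt-mono (B + b) (k ∸ b) i ⟩
      cnt (B + b + (k ∸ b)) i   ≡⟨ cong (λ x → cnt x i) (trans (+-assoc B b (k ∸ b)) (cong (B +_) (m+[n∸m]≡n b≤k))) ⟩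
      cnt (B + k) i             ≡⟨ cnt-period B i ⟩
      suc (cnt B i)             ≡⟨ +-comm 1 (cnt B i) ⟩
      cnt B i + 1               ∎)
    where
    open ≤-Reasoning
    gap : ∀ {x} → cnt (B + b) i ∸ cnt B i ≡ suc x → cnt B i < cnt (B + b) i
    gap h = ≰⇒> (λ le → 0≢1+n (trans (sym (m≤n⇒m∸n≡0 le)) h))

  count-row : ∀ B b → b ≤ k → count (row B b) ≡ b
  count-row B b b≤k = +-cancelˡ-≡ B _ _ (begin
    B + count (row B b)                    ≡⟨ cong (_+ count (row B b)) (sum-cnt B) ⟨
    sumFin (cnt B) + count (row B b)       ≡⟨ sum-+ (cnt B) (⟦_⟧ ∘ row B b) ⟨
    sumFin (λ i → cnt B i + ⟦ row B b i ⟧) ≡⟨ sum-cong (row-cnt B b b≤k) ⟩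
    sumFin (cnt (B + b))                   ≡⟨ sum-cnt (B + b) ⟩
    B + b                                  ∎)
    where open ≡-Reasoning

  -- `s = false` sums over `Z`, `s = true` over its complement.
  part : ∀ {n} → Bool → (Fin n → Bool) → (Fin n → ℕ) → ℕ
  part s Z b = sumFin (λ v → if Z v xor s then b v else 0)

  sum-parts : ∀ {n} Z (b : Fin n → ℕ) → part false Z b + part true Z b ≡ sumFin b
  sum-parts Z b = trans (sym (sum-+ (λ v → if Z v xor false then b v else 0) (λ v → if Z v xor true then b v else 0)))
    (sum-cong pt)
    where
    pt : ∀ v → (if Z v xor false then b v else 0) + (if Z v xor true then b v else 0) ≡ b v
    pt v with Z v
    ... | true  = +-identityʳ (b v)
    ... | false = refl

  -- `B` and `B'` are the current positions in the cyclic order for `Z` and for its complement. Each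
  -- vertex advances the position of its side by `b v`, and the counts of `row-cnt` telescope.
  rows : ∀ {n} (b : Fin n → ℕ) → (∀ v → b v ≤ k) → (Z : Fin n → Bool) → ∀ B B' →
    Σ[ S ∈ (Fin n → Fin k → Bool) ] (∀ v → count (S v) ≡ b v)
      × (∀ i → cnt B i + cnt B' i + sumFin (λ v → ⟦ S v i ⟧)
               ≡ cnt (B + part false Z b) i + cnt (B' + part true Z b) i)
  rows {zero} b le Z B B' = (λ ()) , (λ ()) , λ i → trans (+-identityʳ _)
    (cong₂ (λ x y → cnt x i + cnt y i) (sym (+-identityʳ B)) (sym (+-identityʳ B')))
  rows {suc n} b le Z B B' with Z zero
  ... | true with rows (b ∘ suc) (le ∘ suc) (Z ∘ suc) (B + b zero) B'
  ...   | S , size , bal = (λ { zero → row B (b zero) ; (suc v) → S v })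
          , (λ { zero → count-row B (b zero) (le zero) ; (suc v) → size v })
          , λ i → trans (solve 4 (λ x y s t → x :+ y :+ (s :+ t) := x :+ s :+ y :+ t) refl
                          (cnt B i) (cnt B' i) ⟦ row B (b zero) i ⟧ (sumFin (λ v → ⟦ S v i ⟧)))
              (trans (cong (λ x → x + cnt B' i + sumFin (λ v → ⟦ S v i ⟧)) (row-cnt B (b zero) (le zero) i))
              (trans (bal i) (cong (λ x → cnt x i + cnt (B' + part true (Z ∘ suc) (b ∘ suc)) i) (+-assoc B (b zero) _))))
    where open +-*-Solver hiding (⟦_⟧)
  rows {suc n} b le Z B B' | false with rows (b ∘ suc) (le ∘ suc) (Z ∘ suc) B (B' + b zero)
  ...   | S , size , bal = (λ { zero → row B' (b zero) ; (suc v) → S v })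
          , (λ { zero → count-row B' (b zero) (le zero) ; (suc v) → size v })
          , λ i → trans (solve 4 (λ x y s t → x :+ y :+ (s :+ t) := x :+ (y :+ s) :+ t) refl
                          (cnt B i) (cnt B' i) ⟦ row B' (b zero) i ⟧ (sumFin (λ v → ⟦ S v i ⟧)))
              (trans (cong (λ x → cnt B i + x + sumFin (λ v → ⟦ S v i ⟧)) (row-cnt B' (b zero) (le zero) i))
              (trans (bal i) (cong (λ x → cnt (B + part false (Z ∘ suc) (b ∘ suc)) i + cnt x i) (+-assoc B' (b zero) _))))
    where open +-*-Solver hiding (⟦_⟧)

  part-div : ∀ {n} s Z (d : Fin n → ℕ) →
    part s Z d ≡ part s Z (λ v → d v % k) + part s Z (λ v → d v / k) * k
  part-div s Z d = begin
    part s Z d ≡⟨ sum-cong pt ⟩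
    sumFin (λ v → at (λ v → d v % k) v + k * at (λ v → d v / k) v)
      ≡⟨ sum-+ (at (λ v → d v % k)) (λ v → k * at (λ v → d v / k) v) ⟩
    part s Z (λ v → d v % k) + sumFin (λ v → k * at (λ v → d v / k) v)
      ≡⟨ cong (part s Z (λ v → d v % k) +_) (trans (sum-* k (at (λ v → d v / k))) (*-comm k _)) ⟩
    part s Z (λ v → d v % k) + part s Z (λ v → d v / k) * k ∎
    where
    open ≡-Reasoning
    at : (Fin _ → ℕ) → Fin _ → ℕ
    at f v = if Z v xor s then f v else 0
    pt : ∀ v → at d v ≡ at (λ v → d v % k) v + k * at (λ v → d v / k) v
    pt v with Z v xor s
    ... | true  = trans (m≡m%n+[m/n]*n (d v) k) (cong (d v % k +_) (*-comm (d v / k) k))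
    ... | false = sym (*-zeroʳ k)

  -- Both Z and its complement have degree sum ≡ m, so filling the sets S v cyclically and
  -- separately on the two sides covers every colour equally often modulo 2.
  parity-sets : ∀ {n} m (d : Fin n → ℕ) (Z : Fin n → Bool) → sumFin d ≡ m + m →
    m % k ≡ sumFin (λ v → if Z v then d v else 0) % k →
    Σ[ S ∈ (Fin n → Fin k → Bool) ] (∀ v → count (S v) ≡ d v % k)
      × (∀ i → odd (sumFin (λ v → d v / k) + sumFin (λ v → ⟦ S v i ⟧)) ≡ false)
  parity-sets {n} m d Z total cong-m = S , size , even
    where
    b q : Fin n → ℕ
    b v = d v % k
    q v = d v / k
    A B Q μ : ℕ
    A = part false Z b
    B = part true Z b
    Q = sumFin q
    μ = m % k
    RR = rows b (λ v → <⇒≤ (m%n<n (d v) k)) Z 0 0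
    S = proj₁ RR
    size = proj₁ (proj₂ RR)
    A≡ : A % k ≡ μ
    A≡ = begin
      A % k                              ≡⟨ [m+kn]%n≡m%n A (part false Z q) k ⟨
      (A + part false Z q * k) % k       ≡⟨ cong (_% k) (part-div false Z d) ⟨
      part false Z d % k                 ≡⟨ cong (_% k) (sum-cong (λ v → cong (λ x → if x then d v else 0) (Boolₚ.xor-identityʳ (Z v)))) ⟩
      sumFin (λ v → if Z v then d v else 0) % k ≡⟨ cong-m ⟨
      μ                                  ∎
      where open ≡-Reasoning
    total′ : A + B + Q * k ≡ m + m
    total′ = begin
      A + B + Q * k                                    ≡⟨ cong (λ x → A + B + x * k) (sum-parts Z q) ⟨
      A + B + (part false Z q + part true Z q) * k     ≡⟨ solve 5 (λ a b c e k → a :+ b :+ (c :+ e) :* k := a :+ c :* k :+ (b :+ e :* k)) refl A B (part false Z q) (part true Z q) k ⟩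
      (A + part false Z q * k) + (B + part true Z q * k) ≡⟨ cong₂ _+_ (part-div false Z d) (part-div true Z d) ⟨
      part false Z d + part true Z d                   ≡⟨ sum-parts Z d ⟩
      sumFin d                                         ≡⟨ total ⟩
      m + m                                            ∎
      where
      open ≡-Reasoning
      open +-*-Solver hiding (⟦_⟧)
    w w₀ w′ : ℕ
    w = A / k
    w₀ = m / k
    w′ = B / k
    A-div : A ≡ μ + w * k
    A-div = trans (m≡m%n+[m/n]*n A k) (cong (_+ w * k) A≡)
    m-div : m ≡ μ + w₀ * k
    m-div = m≡m%n+[m/n]*n m k
    B≡ : B % k ≡ μ
    B≡ = begin
      B % k                       ≡⟨ [m+kn]%n≡m%n B (w + Q) k ⟨
      (B + (w + Q) * k) % k       ≡⟨ cong (_% k) (+-cancelˡ-≡ μ _ _ shifted) ⟩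
      (m + w₀ * k) % k            ≡⟨ [m+kn]%n≡m%n m w₀ k ⟩
      μ                           ∎
      where
      open ≡-Reasoning
      open +-*-Solver hiding (⟦_⟧)
      shifted : μ + (B + (w + Q) * k) ≡ μ + (m + w₀ * k)
      shifted = begin
        μ + (B + (w + Q) * k)     ≡⟨ solve 5 (λ μ b w q k → μ :+ (b :+ (w :+ q) :* k) := μ :+ w :* k :+ b :+ q :* k) refl μ B w Q k ⟩
        μ + w * k + B + Q * k     ≡⟨ cong (λ x → x + B + Q * k) A-div ⟨
        A + B + Q * k             ≡⟨ total′ ⟩
        m + m                     ≡⟨ cong (_+ m) m-div ⟩
        μ + w₀ * k + m            ≡⟨ solve 3 (λ μ x m → μ :+ x :+ m := μ :+ (m :+ x)) refl μ (w₀ * k) m ⟩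
        μ + (m + w₀ * k)          ∎
    B-div : B ≡ μ + w′ * k
    B-div = trans (m≡m%n+[m/n]*n B k) (cong (_+ w′ * k) B≡)
    -- In `A + B + Q * k ≡ m + m` the residues on both sides are `μ + μ`; comparing the multiples of
    -- `k` shows that `Q + (w + w′)` is even.
    wraps : Q + (w + w′) ≡ w₀ + w₀
    wraps = *-cancelʳ-≡ _ _ k (+-cancelˡ-≡ (μ + μ) _ _ (begin
      μ + μ + (Q + (w + w′)) * k               ≡⟨ solve 5 (λ μ q w v k → μ :+ μ :+ (q :+ (w :+ v)) :* k := μ :+ w :* k :+ (μ :+ v :* k) :+ q :* k) refl μ Q w w′ k ⟩
      μ + w * k + (μ + w′ * k) + Q * k         ≡⟨ cong₂ (λ x y → x + y + Q * k) A-div B-div ⟨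
      A + B + Q * k                            ≡⟨ total′ ⟩
      m + m                                    ≡⟨ cong₂ _+_ m-div m-div ⟩
      (μ + w₀ * k) + (μ + w₀ * k)              ≡⟨ solve 3 (λ μ w k → μ :+ w :* k :+ (μ :+ w :* k) := μ :+ μ :+ (w :+ w) :* k) refl μ w₀ k ⟩
      μ + μ + (w₀ + w₀) * k                    ∎))
      where
      open ≡-Reasoning
      open +-*-Solver hiding (⟦_⟧)
    -- Both sides end at the same residue `μ`, so the only term that depends on the colour,
    -- `cnt μ i`, occurs twice.
    even : ∀ i → odd (Q + sumFin (λ v → ⟦ S v i ⟧)) ≡ false
    even i = trans (cong odd (begin
        Q + sumFin (λ v → ⟦ S v i ⟧)              ≡⟨ cong (Q +_) (proj₂ (proj₂ RR) i) ⟩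
        Q + (cnt A i + cnt B i)                   ≡⟨ cong₂ (λ x y → Q + (cnt x i + cnt y i)) A-div B-div ⟩
        Q + (cnt (μ + w * k) i + cnt (μ + w′ * k) i) ≡⟨ cong₂ (λ x y → Q + (x + y)) (cnt-periods w μ i) (cnt-periods w′ μ i) ⟩
        Q + ((cnt μ i + w) + (cnt μ i + w′))      ≡⟨ solve 4 (λ q c w v → q :+ (c :+ w :+ (c :+ v)) := c :+ c :+ (q :+ (w :+ v))) refl Q (cnt μ i) w w′ ⟩
        cnt μ i + cnt μ i + (Q + (w + w′))        ≡⟨ cong (cnt μ i + cnt μ i +_) wraps ⟩
        cnt μ i + cnt μ i + (w₀ + w₀)             ∎))
      (trans (odd-+ (cnt μ i + cnt μ i) (w₀ + w₀)) (cong₂ _xor_ (odd-double (cnt μ i)) (odd-double w₀)))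
      where
      open ≡-Reasoning
      open +-*-Solver hiding (⟦_⟧)

-- The auxiliary graph

record Packed {n m} (G : Graph n m) (κ : ℕ) : Set where
  field
    part      : Fin κ → Fin m → Bool
    connected : ∀ i → ConnectedSub G (part i)
    disjoint  : ∀ i j e → part i e ≡ true → part j e ≡ true → i ≡ j

sum-degIn-colour : ∀ {n m k} (G : Graph n m) (c : Fin m → Fin k) z →
  sumFin (λ l → degIn G (colour c l) z) ≡ deg G z
sum-degIn-colour G c z = trans (sum-swap (λ l e → if colour c l e then ends G e z else 0))
  (sum-cong (λ e → sum-δ (c e) (λ _ → ends G e z)))

-- The T-joins lie in disjoint parts and become the colours `suc i`. Colour `zero` takes all other
-- edges; its parities are forced, and `total` says that they are the right ones.
parity-colouring : ∀ {n m κ} (G : Graph n m) → Packed G κ → (T : Fin (suc κ) → Fin n → Bool) →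
  (∀ i → ⊕ (T i) ≡ false) → (∀ z → ⊕ (λ i → T i z) ≡ odd (deg G z)) →
  Σ[ c ∈ (Fin m → Fin (suc κ)) ] ∀ i z → odd (degIn G (colour c i) z) ≡ T i z
parity-colouring {n} {m} {κ} G packed T even total = c , correct
  where
  open Packed packed
  joins : ∀ i → Σ[ K ∈ (Fin m → Bool) ] K ⊑ part i × ∀ z → odd (degIn G K z) ≡ T (suc i) z
  joins i = T-join G (connected i) (T (suc i)) (even (suc i))
  K : Fin κ → Fin m → Bool
  K i = proj₁ (joins i)
  pick : ∀ {P : Fin κ → Set} → Dec (∃ P) → Fin (suc κ)
  pick (yes (i , _)) = suc i
  pick (no _)        = zero
  c : Fin m → Fin (suc κ)
  c e = pick (any? (λ i → K i e Boolₚ.≟ true))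
  c-suc : ∀ i e → colour c (suc i) e ≡ K i e
  c-suc i e with any? (λ i → K i e Boolₚ.≟ true) | K i e in Kie
  ... | yes (j , Kj) | true  = trans (cong (λ x → eqᵇ (suc x) (suc i))
        (disjoint j i e (proj₁ (proj₂ (joins j)) e Kj) (proj₁ (proj₂ (joins i)) e Kie))) (eqᵇ-refl (suc i))
  ... | yes (j , Kj) | false = eqᵇ-≢ {u = suc j} {suc i} (λ { refl → true≢false Kj Kie })
  ... | no ¬p        | true  = contradiction (i , Kie) ¬p
  ... | no ¬p        | false = refl
  correct : ∀ i z → odd (degIn G (colour c i) z) ≡ T i z
  correct (suc i) z = trans (cong odd (degIn-cong G (c-suc i) z)) (proj₂ (proj₂ (joins i)) z)
  correct zero    z = xor-cancelʳ _ _ (⊕ (λ i → T (suc i) z)) (begin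
    odd (degIn G (colour c zero) z) xor ⊕ (λ i → T (suc i) z)
      ≡⟨ cong (odd (degIn G (colour c zero) z) xor_) (⊕-cong (λ i → correct (suc i) z)) ⟨
    ⊕ (λ l → odd (degIn G (colour c l) z)) ≡⟨ odd-sum (λ l → degIn G (colour c l) z) ⟨
    odd (sumFin (λ l → degIn G (colour c l) z)) ≡⟨ cong odd (sum-degIn-colour G c z) ⟩
    odd (deg G z) ≡⟨ total z ⟨
    ⊕ (λ i → T i z) ∎)
    where open ≡-Reasoning

sum-↑ : ∀ a b (f : Fin (a + b) → ℕ) → sumFin f ≡ sumFin (λ i → f (i ↑ˡ b)) + sumFin (λ j → f (a ↑ʳ j))
sum-↑ zero    b f = refl
sum-↑ (suc a) b f = trans (cong (f zero +_) (sum-↑ a b (f ∘ suc))) (sym (+-assoc (f zero) _ _))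

sum-combine : ∀ a b (f : Fin (a * b) → ℕ) → sumFin f ≡ sumFin (λ i → sumFin (λ j → f (combine {a} {b} i j)))
sum-combine zero    b f = refl
sum-combine (suc a) b f = trans (sum-↑ b (a * b) f)
  (cong (sumFin (λ j → f (j ↑ˡ (a * b))) +_) (sum-combine a b (λ x → f (b ↑ʳ x))))

sum-select : ∀ {n} u (f : Fin n → ℕ) → sumFin (λ v → if eqᵇ v u then f v else 0) ≡ f u
sum-select u f = trans (sum-cong (λ v → if-cong (eqᵇ-sym v u))) (sum-δ u f)

odd-near : ∀ {x y} → odd x ≡ odd y → x < y → 2 + x ≤ y
odd-near {x} {y} p lt = ≤∧≢⇒< lt λ { refl → not-fixed (odd x) (sym p) }
  where
  not-fixed : ∀ b → not b ≢ b
  not-fixed true ()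
  not-fixed false ()

-- A value below `Q` is at most `Q ∸ 2` by parity, so no value exceeds `Q` and the sum falls short
-- of `k * Q`. A value above `Q` is excluded symmetrically.
exact : ∀ {k} (f : Fin k → ℕ) Q → sumFin f ≡ k * Q → (∀ l → odd (f l) ≡ odd Q) →
  (∀ l l' → f l ≤ 2 + f l') → ∀ l → f l ≡ Q
exact {k} f Q total par near l with <-cmp (f l) Q
... | tri≈ _ p _ = p
... | tri< lt _ _ = contradiction (trans total (sym (sum-const k Q)))
  (<⇒≢ (sum-mono-< (λ l' → ≤-trans (near l' l) (odd-near (par l) lt)) l lt))
... | tri> _ _ gt = contradiction (sym (trans total (sym (sum-const k Q))))
  (<⇒≢ (sum-mono-< (λ l' → ≤-pred (≤-pred (≤-trans (odd-near (sym (par l)) gt) (near l l')))) l gt))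

Equitable : ∀ {n m k} → Graph n m → (Fin m → Fin k) → Set
Equitable {n} {m} {k} G c = ((i : Fin k) → CloseTo k (count (colour c i)) m)
  × ((i : Fin k) (v : Fin n) → CloseTo k (degIn G (colour c i) v) (deg G v))

-- Every vertex v gets a companion y v of degree k; the edge from y v of colour j leads to the
-- common vertex w if j ∈ S v, and to v otherwise. Making all colours equally frequent at v and at
-- y v makes the degrees of G equitable, and w records the sizes of the colour classes.
module Gadget {n m κ} (G : Graph n m) (S : Fin n → Fin (suc κ) → Bool) where

  k : ℕ
  k = suc κ

  V E : ℕ
  V = suc (n + n)
  E = m + n * k

  w : Fin V
  w = zero
  emb y : Fin n → Fin V
  emb v = suc (v ↑ˡ n)
  y   v = suc (n ↑ʳ v)

  vertex-elim : (P : Fin V → Set) → P w → (∀ v → P (emb v)) → (∀ v → P (y v)) → ∀ z → P z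
  vertex-elim P pw pe py zero    = pw
  vertex-elim P pw pe py (suc x) with splitAt n x | Finₚ.join-splitAt n n x
  ... | inj₁ v | refl = pe v
  ... | inj₂ v | refl = py v

  spoke : Fin n × Fin k → Fin V × Fin V
  spoke (v , j) = y v , (if S v j then w else emb v)

  H : Graph V E
  H e with splitAt m e
  ... | inj₁ e′ = emb (proj₁ (G e′)) , emb (proj₂ (G e′))
  ... | inj₂ f  = spoke (remQuot k f)

  old : Fin m → Fin E
  old e = e ↑ˡ (n * k)
  new : Fin n → Fin k → Fin E
  new v j = m ↑ʳ combine v j

  H-old : ∀ e → H (old e) ≡ (emb (proj₁ (G e)) , emb (proj₂ (G e)))
  H-old e rewrite Finₚ.splitAt-↑ˡ m e (n * k) = refl

  H-new : ∀ v j → H (new v j) ≡ (y v , (if S v j then w else emb v))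
  H-new v j rewrite Finₚ.splitAt-↑ʳ m (n * k) (combine v j) = cong spoke (Finₚ.remQuot-combine v j)

  eqᵇ-inj : ∀ {a b} (f : Fin a → Fin b) → (∀ {u v} → f u ≡ f v → u ≡ v) → ∀ u v → eqᵇ (f u) (f v) ≡ eqᵇ u v
  eqᵇ-inj f inj u v with u Finₚ.≟ v
  ... | yes refl = eqᵇ-refl (f u)
  ... | no u≢v   = eqᵇ-≢ (u≢v ∘ inj)

  emb-inj : ∀ {u v} → emb u ≡ emb v → u ≡ v
  emb-inj {u} {v} p = Finₚ.↑ˡ-injective n u v (Finₚ.suc-injective p)
  y-inj : ∀ {u v} → y u ≡ y v → u ≡ v
  y-inj {u} {v} p = Finₚ.↑ʳ-injective n u v (Finₚ.suc-injective p)
  emb≢y : ∀ u v → emb u ≢ y v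
  emb≢y u v p with trans (sym (Finₚ.splitAt-↑ˡ n u n)) (trans (cong (splitAt n) (Finₚ.suc-injective p)) (Finₚ.splitAt-↑ʳ n n v))
  ... | ()

  module Degrees (C : Fin E → Fin k) where

    restrict : Fin m → Fin k
    restrict e = C (old e)
    spokes : Fin k → Fin n → Fin k → Bool
    spokes l v j = eqᵇ (C (new v j)) l
    -- Among the edges of colour `l` at `y v`, those leading to the hub `w` and those leading to
    -- `emb v`.
    inward outward : Fin k → Fin n → ℕ
    inward  l v = count (λ j → spokes l v j ∧ S v j)
    outward l v = count (λ j → spokes l v j ∧ not (S v j))
    hub : Fin k → ℕ
    hub l = sumFin (inward l)
    dH : Fin k → Fin V → ℕ
    dH l = degIn H (colour C l)

    at-spoke : Fin V → Fin n → Fin k → ℕ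
    at-spoke z v j = ⟦ eqᵇ (y v) z ⟧ + ⟦ eqᵇ (if S v j then w else emb v) z ⟧

    split : ∀ l z → dH l z ≡
      sumFin (λ e → if colour restrict l e then ⟦ eqᵇ (emb (proj₁ (G e))) z ⟧ + ⟦ eqᵇ (emb (proj₂ (G e))) z ⟧ else 0)
      + sumFin (λ v → sumFin (λ j → if spokes l v j then at-spoke z v j else 0))
    split l z = trans (sum-↑ m (n * k) (λ e → if colour C l e then ends H e z else 0))
      (cong₂ _+_ (sum-cong (λ e → cong (λ p → if colour restrict l e then ⟦ eqᵇ (proj₁ p) z ⟧ + ⟦ eqᵇ (proj₂ p) z ⟧ else 0) (H-old e)))
        (trans (sum-combine n k (λ f → if colour C l (m ↑ʳ f) then ends H (m ↑ʳ f) z else 0))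
          (sum-cong (λ v → sum-cong (λ j → cong (λ p → if spokes l v j then ⟦ eqᵇ (proj₁ p) z ⟧ + ⟦ eqᵇ (proj₂ p) z ⟧ else 0) (H-new v j))))))

    if-0 : ∀ b {x} → x ≡ 0 → (if b then x else 0) ≡ 0
    if-0 true  p = p
    if-0 false p = refl

    away : ∀ l z → (∀ v → emb v ≢ z) →
      sumFin (λ e → if colour restrict l e then ⟦ eqᵇ (emb (proj₁ (G e))) z ⟧ + ⟦ eqᵇ (emb (proj₂ (G e))) z ⟧ else 0) ≡ 0
    away l z h = trans (sum-cong (λ e → if-0 (colour restrict l e)
      (cong₂ (λ a b → ⟦ a ⟧ + ⟦ b ⟧) (eqᵇ-≢ (h _)) (eqᵇ-≢ (h _))))) (sum-0 m)

    dH-emb : ∀ l u → dH l (emb u) ≡ degIn G (colour restrict l) u + outward l u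
    dH-emb l u = trans (split l (emb u)) (cong₂ _+_
      (sum-cong (λ e → cong₂ (λ a b → if colour restrict l e then ⟦ a ⟧ + ⟦ b ⟧ else 0)
        (eqᵇ-inj emb emb-inj (proj₁ (G e)) u) (eqᵇ-inj emb emb-inj (proj₂ (G e)) u)))
      (trans (sum-cong per-vertex) (sum-select u (outward l))))
      where
      spoke-end : ∀ v j → at-spoke (emb u) v j ≡ (if eqᵇ v u then ⟦ not (S v j) ⟧ else 0)
      spoke-end v j rewrite eqᵇ-≢ (emb≢y u v ∘ sym) with S v j
      ... | false = trans (cong ⟦_⟧ (eqᵇ-inj emb emb-inj v u)) refl
      ... | true  = sym (if-0 (eqᵇ v u) refl)
      per-vertex : ∀ v → sumFin (λ j → if spokes l v j then at-spoke (emb u) v j else 0)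
        ≡ (if eqᵇ v u then outward l v else 0)
      per-vertex v = trans (sum-cong (λ j → cong (λ x → if spokes l v j then x else 0) (spoke-end v j))) (lem (eqᵇ v u))
        where
        lem : ∀ b → sumFin (λ j → if spokes l v j then (if b then ⟦ not (S v j) ⟧ else 0) else 0)
          ≡ (if b then outward l v else 0)
        lem true  = sum-cong pt
          where
          pt : ∀ j → (if spokes l v j then ⟦ not (S v j) ⟧ else 0) ≡ ⟦ spokes l v j ∧ not (S v j) ⟧
          pt j with spokes l v j
          ... | true  = refl
          ... | false = refl
        lem false = trans (sum-cong (λ j → if-0 (spokes l v j) refl)) (sum-0 k)

    dH-y : ∀ l u → dH l (y u) ≡ count (spokes l u)
    dH-y l u = trans (split l (y u)) (trans (cong (_+ sumFin (λ v → sumFin (λ j → if spokes l v j then at-spoke (y u) v j else 0)))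
        (away l (y u) (λ v → emb≢y v u)))
      (trans (sum-cong per-vertex) (sum-select u (λ v → count (spokes l v)))))
      where
      spoke-end : ∀ v j → at-spoke (y u) v j ≡ ⟦ eqᵇ v u ⟧
      spoke-end v j with S v j
      ... | true  = trans (+-identityʳ _) (cong ⟦_⟧ (eqᵇ-inj y y-inj v u))
      ... | false = trans (cong (λ b → ⟦ eqᵇ (y v) (y u) ⟧ + ⟦ b ⟧) (eqᵇ-≢ (emb≢y v u)))
                      (trans (+-identityʳ _) (cong ⟦_⟧ (eqᵇ-inj y y-inj v u)))
      per-vertex : ∀ v → sumFin (λ j → if spokes l v j then at-spoke (y u) v j else 0)
        ≡ (if eqᵇ v u then count (spokes l v) else 0)
      per-vertex v = trans (sum-cong (λ j → cong (λ x → if spokes l v j then x else 0) (spoke-end v j))) (lem (eqᵇ v u))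
        where
        lem : ∀ b → sumFin (λ j → if spokes l v j then ⟦ b ⟧ else 0) ≡ (if b then count (spokes l v) else 0)
        lem true  = refl
        lem false = trans (sum-cong (λ j → if-0 (spokes l v j) refl)) (sum-0 k)

    dH-w : ∀ l → dH l w ≡ hub l
    dH-w l = trans (split l w) (trans (cong (_+ sumFin (λ v → sumFin (λ j → if spokes l v j then at-spoke w v j else 0)))
        (away l w (λ v ())))
      (sum-cong (λ v → sum-cong (pt v))))
      where
      pt : ∀ v j → (if spokes l v j then at-spoke w v j else 0) ≡ ⟦ spokes l v j ∧ S v j ⟧
      pt v j with spokes l v j | S v j
      ... | true  | true  = refl
      ... | true  | false = refl
      ... | false | _     = refl

    in+out : ∀ l v → inward l v + outward l v ≡ count (spokes l v)
    in+out l v = trans (sym (sum-+ (λ j → ⟦ spokes l v j ∧ S v j ⟧) (λ j → ⟦ spokes l v j ∧ not (S v j) ⟧))) (sum-cong pt)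
      where
      pt : ∀ j → ⟦ spokes l v j ∧ S v j ⟧ + ⟦ spokes l v j ∧ not (S v j) ⟧ ≡ ⟦ spokes l v j ⟧
      pt j with spokes l v j | S v j
      ... | true  | true  = refl
      ... | true  | false = refl
      ... | false | _     = refl

    inward≤ : ∀ l v → inward l v ≤ count (S v)
    inward≤ l v = sum-mono pt
      where
      pt : ∀ j → ⟦ spokes l v j ∧ S v j ⟧ ≤ ⟦ S v j ⟧
      pt j with spokes l v j
      ... | true  = ≤-refl
      ... | false = z≤n

  -- The edge of index `j` at a companion starts with colour `j`. So `y v` sees every colour once,
  -- and `v` gains one end in just the colours outside `S v`, which aligns all parities there with
  -- that of `q v + 1`.
  extend : (Fin m → Fin k) → Fin E → Fin k
  extend c e with splitAt m e
  ... | inj₁ e′ = c e′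
  ... | inj₂ f  = proj₂ (remQuot {n} k f)

  extend-old : ∀ c e → extend c (old e) ≡ c e
  extend-old c e rewrite Finₚ.splitAt-↑ˡ m e (n * k) = refl

  extend-new : ∀ c v j → extend c (new v j) ≡ j
  extend-new c v j rewrite Finₚ.splitAt-↑ʳ m (n * k) (combine v j) = cong proj₂ (Finₚ.remQuot-combine v j)

-- Equitable colourings

count-not : ∀ {m} (F : Fin m → Bool) → count F + count (not ∘ F) ≡ m
count-not {m} F = trans (sym (sum-+ (⟦_⟧ ∘ F) (⟦_⟧ ∘ not ∘ F)))
  (trans (sum-cong pt) (trans (sum-const m 1) (*-identityʳ m)))
  where
  pt : ∀ e → ⟦ F e ⟧ + ⟦ not (F e) ⟧ ≡ 1
  pt e with F e
  ... | true  = refl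
  ... | false = refl

count-select : ∀ {m} (F : Fin m → Bool) l → count (λ j → eqᵇ j l ∧ F j) ≡ ⟦ F l ⟧
count-select F l = trans (sum-cong pt) (sum-select l (⟦_⟧ ∘ F))
  where
  pt : ∀ j → ⟦ eqᵇ j l ∧ F j ⟧ ≡ (if eqᵇ j l then ⟦ F j ⟧ else 0)
  pt j with eqᵇ j l
  ... | true  = refl
  ... | false = refl

-- The condition `ι ≤ b` rules out `x ≡ q + 1` when `k` divides `d`; there the strict upper bound
-- would fail.
closeTo-div : ∀ {k d q b ι x} → d ≡ b + q * k → b < k → ι ≤ 1 → ι ≤ b → x ≡ q + ι → CloseTo k x d
closeTo-div {k} {q = q} {b} {ι} refl b<k ι≤1 ι≤b refl = upper ι≤1 ι≤b , lower
  where
  open ≤-Reasoning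
  upper : ∀ {ι} → ι ≤ 1 → ι ≤ b → k * (q + ι) < b + q * k + k
  upper {zero} _ _ = begin-strict
    k * (q + 0)    ≡⟨ trans (cong (k *_) (+-identityʳ q)) (*-comm k q) ⟩
    q * k          ≤⟨ m≤n+m (q * k) b ⟩
    b + q * k      <⟨ m<m+n (b + q * k) (≤-<-trans z≤n b<k) ⟩
    b + q * k + k  ∎
  upper {suc zero} _ 1≤b = begin-strict
    k * (q + 1)    ≡⟨ trans (cong (k *_) (+-comm q 1)) (*-comm k (suc q)) ⟩
    k + q * k      ≡⟨ +-comm k (q * k) ⟩
    q * k + k      <⟨ +-monoˡ-≤ (q * k + k) 1≤b ⟩
    b + (q * k + k) ≡⟨ +-assoc b (q * k) k ⟨
    b + q * k + k  ∎
  upper {suc (suc _)} (s≤s ())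
  lower : b + q * k < k * (q + ι) + k
  lower = begin-strict
    b + q * k        <⟨ +-monoˡ-< (q * k) b<k ⟩
    k + q * k        ≡⟨ +-comm k (q * k) ⟩
    q * k + k        ≡⟨ cong (_+ k) (*-comm q k) ⟩
    k * q + k        ≤⟨ +-monoˡ-≤ k (*-monoʳ-≤ k (m≤m+n q ι)) ⟩
    k * (q + ι) + k  ∎

-- The sum is compared with `k` copies of `s i`; the term at `i` itself makes the comparison strict.
closeTo-sum : ∀ {k m} (s : Fin k → ℕ) → sumFin s ≡ m → (∀ i j → s i ≤ 1 + s j) → ∀ i → CloseTo k (s i) m
closeTo-sum {k} s refl near i = upper , lower
  where
  open ≤-Reasoning
  upper : k * s i < sumFin s + k
  upper = begin-strict
    k * s i                    ≡⟨ sum-const k (s i) ⟨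
    sumFin {k} (λ _ → s i)     <⟨ sum-mono-< (near i) i (n<1+n (s i)) ⟩
    sumFin (λ j → 1 + s j)     ≡⟨ sum-+ (λ _ → 1) s ⟩
    sumFin {k} (λ _ → 1) + sumFin s ≡⟨ cong (_+ sumFin s) (trans (sum-const k 1) (*-identityʳ k)) ⟩
    k + sumFin s               ≡⟨ +-comm k (sumFin s) ⟩
    sumFin s + k               ∎
  lower : sumFin s < k * s i + k
  lower = begin-strict
    sumFin s                    <⟨ sum-mono-< (λ j → near j i) i (n<1+n (s i)) ⟩
    sumFin {k} (λ _ → 1 + s i)  ≡⟨ sum-const k (1 + s i) ⟩
    k * suc (s i)               ≡⟨ *-suc k (s i) ⟩
    k + k * s i                 ≡⟨ +-comm k (k * s i) ⟩
    k * s i + k                 ∎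

halve : ∀ {x y} → x + x ≤ 2 + (y + y) → x ≤ 1 + y
halve {x} {y} h = ≮⇒≥ λ lt → contradiction (≤-trans (+-mono-≤ lt lt) h)
  (<⇒≱ (s≤s (s≤s (≤-trans (≤-reflexive (sym (+-suc y y))) (+-monoʳ-≤ y (n≤1+n (suc y)))))))

module Equalize {n m κ} (G : Graph n m) (S : Fin n → Fin (suc κ) → Bool)
  (size : ∀ v → count (S v) ≡ deg G v % suc κ)
  (even : ∀ i → odd (sumFin (λ v → deg G v / suc κ) + sumFin (λ v → ⟦ S v i ⟧)) ≡ false)
  (c : Fin m → Fin (suc κ))
  (par : ∀ i z → odd (degIn G (colour c i) z) ≡ odd (deg G z / suc κ) xor S z i) where

  open Gadget G S
  module Start = Degrees (extend c)

  q : Fin n → ℕ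
  q v = deg G v / k

  start-emb : ∀ l u → Start.dH l (emb u) ≡ degIn G (colour c l) u + ⟦ not (S u l) ⟧
  start-emb l u = trans (Start.dH-emb l u) (cong₂ _+_
    (degIn-cong G (λ e → cong (λ x → eqᵇ x l) (extend-old c e)) u)
    (trans (sum-cong (λ j → cong (λ x → ⟦ eqᵇ x l ∧ not (S u j) ⟧) (extend-new c u j)))
           (count-select (not ∘ S u) l)))

  start-y : ∀ l u → Start.dH l (y u) ≡ 1
  start-y l u = trans (Start.dH-y l u) (trans (sum-cong (λ j → cong (λ x → ⟦ eqᵇ x l ⟧) (extend-new c u j)))
    (trans (sum-cong (λ j → cong ⟦_⟧ (eqᵇ-sym j l))) (count-eqᵇ l)))

  start-w : ∀ l → Start.dH l w ≡ sumFin (λ v → ⟦ S v l ⟧)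
  start-w l = trans (Start.dH-w l) (sum-cong (λ v →
    trans (sum-cong (λ j → cong (λ x → ⟦ eqᵇ x l ∧ S v j ⟧) (extend-new c v j))) (count-select (S v) l)))

  odd-emb : ∀ l u → odd (Start.dH l (emb u)) ≡ odd (suc (q u))
  odd-emb l u = begin
    odd (Start.dH l (emb u))                                  ≡⟨ cong odd (start-emb l u) ⟩
    odd (degIn G (colour c l) u + ⟦ not (S u l) ⟧)            ≡⟨ odd-+ (degIn G (colour c l) u) ⟦ not (S u l) ⟧ ⟩
    odd (degIn G (colour c l) u) xor odd ⟦ not (S u l) ⟧      ≡⟨ cong₂ _xor_ (par l u) (odd-⟦⟧ (not (S u l))) ⟩
    (odd (q u) xor S u l) xor not (S u l)                     ≡⟨ xor-assoc (odd (q u)) (S u l) (not (S u l)) ⟩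
    odd (q u) xor (S u l xor not (S u l))                     ≡⟨ cong (odd (q u) xor_) (Boolₚ.xor-inverseʳ (S u l)) ⟩
    odd (q u) xor true                                        ≡⟨ xor-comm (odd (q u)) true ⟩
    not (odd (q u))                                           ∎
    where open ≡-Reasoning

  start-parity : ∀ z l l' → odd (Start.dH l z) ≡ odd (Start.dH l' z)
  start-parity = vertex-elim (λ z → ∀ l l' → odd (Start.dH l z) ≡ odd (Start.dH l' z))
    (λ l l' → trans (at-w l) (sym (at-w l')))
    (λ u l l' → trans (odd-emb l u) (sym (odd-emb l' u)))
    (λ u l l' → cong odd (trans (start-y l u) (sym (start-y l' u))))
    where
    at-w : ∀ l → odd (Start.dH l w) ≡ odd (sumFin q)
    at-w l = trans (cong odd (start-w l)) (sym (xor-false (trans (sym (odd-+ (sumFin q) (sumFin (λ v → ⟦ S v l ⟧)))) (even l))))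

  module Result (C : Fin E → Fin k) (same : ∀ l z → odd (degIn H (colour C l) z) ≡ odd (Start.dH l z))
    (near : ∀ z l l' → degIn H (colour C l) z ≤ 2 + degIn H (colour C l') z) where

    open Degrees C

    total : ∀ z → sumFin (λ l → dH l z) ≡ sumFin (λ l → Start.dH l z)
    total z = trans (sum-degIn-colour H C z) (sym (sum-degIn-colour H (extend c) z))

    spokes-1 : ∀ l u → count (spokes l u) ≡ 1
    spokes-1 l u = trans (sym (dH-y l u)) (exact (λ l → dH l (y u)) 1
      (trans (total (y u)) (trans (sum-cong (λ l → start-y l u)) (sum-const k 1)))
      (λ l → trans (same l (y u)) (cong odd (start-y l u))) (near (y u)) l)

    emb-total : ∀ u → sumFin (λ l → dH l (emb u)) ≡ k * suc (q u)
    emb-total u = begin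
      sumFin (λ l → dH l (emb u))       ≡⟨ total (emb u) ⟩
      sumFin (λ l → Start.dH l (emb u)) ≡⟨ sum-cong (λ l → start-emb l u) ⟩
      sumFin (λ l → degIn G (colour c l) u + ⟦ not (S u l) ⟧)
        ≡⟨ sum-+ (λ l → degIn G (colour c l) u) (λ l → ⟦ not (S u l) ⟧) ⟩
      sumFin (λ l → degIn G (colour c l) u) + N ≡⟨ cong (_+ N) (sum-degIn-colour G c u) ⟩
      deg G u + N                       ≡⟨ cong (_+ N) (m≡m%n+[m/n]*n (deg G u) k) ⟩
      deg G u % k + q u * k + N         ≡⟨ cong (λ b → b + q u * k + N) (size u) ⟨
      count (S u) + q u * k + N         ≡⟨ solve 3 (λ a b c → a :+ b :+ c := a :+ c :+ b) refl (count (S u)) (q u * k) N ⟩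
      count (S u) + N + q u * k         ≡⟨ cong (_+ q u * k) (count-not (S u)) ⟩
      k + q u * k                       ≡⟨ *-comm (suc (q u)) k ⟩
      k * suc (q u)                     ∎
      where
      open ≡-Reasoning
      open +-*-Solver hiding (⟦_⟧)
      N : ℕ
      N = count (not ∘ S u)

    -- In the auxiliary graph `u` has degree `q u + 1` in every colour, and its companion has one
    -- edge of colour `l`. That edge takes an end away from `u` unless it leads to the hub.
    degree : ∀ l u → degIn G (colour restrict l) u ≡ q u + inward l u
    degree l u = +-cancelʳ-≡ (outward l u) _ _ (begin
      degIn G (colour restrict l) u + outward l u ≡⟨ dH-emb l u ⟨
      dH l (emb u)                                ≡⟨ exact (λ l → dH l (emb u)) (suc (q u)) (emb-total u)
                                                       (λ l → trans (same l (emb u)) (odd-emb l u)) (near (emb u)) l ⟩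
      suc (q u)                                   ≡⟨ +-comm 1 (q u) ⟩
      q u + 1                                     ≡⟨ cong (q u +_) (trans (in+out l u) (spokes-1 l u)) ⟨
      q u + (inward l u + outward l u)            ≡⟨ +-assoc (q u) (inward l u) (outward l u) ⟨
      q u + inward l u + outward l u              ∎)
      where open ≡-Reasoning

    -- Summing the degrees of one colour class counts its edges twice. Hence a difference of at most
    -- 2 at the hub means class sizes that differ by at most 1.
    class-size : ∀ l → count (colour restrict l) + count (colour restrict l) ≡ sumFin q + hub l
    class-size l = trans (sym (sum-degIn G (colour restrict l)))
      (trans (sum-cong (degree l)) (sum-+ q (inward l)))

    equitable : Equitable G restrict
    equitable = closeTo-sum (λ l → count (colour restrict l)) sizes near-sizes , λ l u →
      closeTo-div {q = q u} {b = deg G u % k} (m≡m%n+[m/n]*n (deg G u) k) (m%n<n (deg G u) k)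
        (subst (inward l u ≤_) (spokes-1 l u) (subst (inward l u ≤_) (in+out l u) (m≤m+n _ _)))
        (subst (inward l u ≤_) (size u) (inward≤ l u)) (degree l u)
      where
      sizes : sumFin (λ l → count (colour restrict l)) ≡ m
      sizes = trans (sum-cong (λ l → sum-cong (λ e → cong ⟦_⟧ (sym (Boolₚ.∧-identityʳ (colour restrict l e))))))
        (trans (sum-colour restrict (λ _ → true)) (trans (sum-const m 1) (*-identityʳ m)))
      near-sizes : ∀ l l' → count (colour restrict l) ≤ 1 + count (colour restrict l')
      near-sizes l l' = halve (begin
        count (colour restrict l) + count (colour restrict l)   ≡⟨ class-size l ⟩
        sumFin q + hub l                                        ≡⟨ cong (sumFin q +_) (dH-w l) ⟨
        sumFin q + dH l w                                       ≤⟨ +-monoʳ-≤ (sumFin q) (near w l l') ⟩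
        sumFin q + (2 + dH l' w)                                ≡⟨ cong (λ x → sumFin q + (2 + x)) (dH-w l') ⟩
        sumFin q + (2 + hub l')                                 ≡⟨ trans (+-suc _ _) (cong suc (+-suc _ _)) ⟩
        2 + (sumFin q + hub l')                                 ≡⟨ cong (2 +_) (class-size l') ⟨
        2 + (count (colour restrict l') + count (colour restrict l')) ∎)
        where open ≤-Reasoning

  solution : ∃ (Equitable G)
  solution = let C , same , near = Balance.balance H (extend c) start-parity in
    Degrees.restrict C , Result.equitable C same near

packed-equitable : ∀ {n m κ} (G : Graph n m) → Packed G κ → (Z : Fin n → Bool) →
  m % suc κ ≡ degSum G Z % suc κ → Σ[ c ∈ (Fin m → Fin (suc κ)) ] Equitable G c
packed-equitable {n} {m} {κ} G packed Z cong-m = Equalize.solution G S size even c par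
  where
  open RoundRobin κ using (parity-sets)
  handshake : sumFin (deg G) ≡ m + m
  handshake = trans (sum-degIn G (λ _ → true)) (cong₂ _+_ (trans (sum-const m 1) (*-identityʳ m)) (trans (sum-const m 1) (*-identityʳ m)))
  PS = parity-sets m (deg G) Z handshake cong-m
  S = proj₁ PS
  size = proj₁ (proj₂ PS)
  even = proj₂ (proj₂ PS)
  q : Fin n → ℕ
  q v = deg G v / suc κ
  T : Fin (suc κ) → Fin n → Bool
  T i v = odd (q v) xor S v i
  T-even : ∀ i → ⊕ (T i) ≡ false
  T-even i = begin
    ⊕ (λ v → odd (q v) xor S v i)              ≡⟨ ⊕-xor (odd ∘ q) (λ v → S v i) ⟩
    ⊕ (odd ∘ q) xor ⊕ (λ v → S v i)            ≡⟨ cong₂ _xor_ (odd-sum q) (trans (odd-sum (λ v → ⟦ S v i ⟧)) (⊕-cong (λ v → odd-⟦⟧ (S v i)))) ⟨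
    odd (sumFin q) xor odd (sumFin (λ v → ⟦ S v i ⟧)) ≡⟨ odd-+ (sumFin q) _ ⟨
    odd (sumFin q + sumFin (λ v → ⟦ S v i ⟧))  ≡⟨ even i ⟩
    false                                      ∎
    where open ≡-Reasoning
  T-total : ∀ z → ⊕ (λ i → T i z) ≡ odd (deg G z)
  T-total z = begin
    ⊕ (λ i → odd (q z) xor S z i)                 ≡⟨ ⊕-cong (λ i → trans (odd-+ (q z) ⟦ S z i ⟧) (cong (odd (q z) xor_) (odd-⟦⟧ (S z i)))) ⟨
    ⊕ (λ i → odd (q z + ⟦ S z i ⟧))               ≡⟨ odd-sum (λ i → q z + ⟦ S z i ⟧) ⟨
    odd (sumFin (λ i → q z + ⟦ S z i ⟧))          ≡⟨ cong odd (sum-+ (λ _ → q z) (λ i → ⟦ S z i ⟧)) ⟩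
    odd (sumFin {suc κ} (λ _ → q z) + count (S z)) ≡⟨ cong odd (cong₂ _+_ (trans (sum-const (suc κ) (q z)) (*-comm (suc κ) (q z))) (size z)) ⟩
    odd (q z * suc κ + deg G z % suc κ)           ≡⟨ cong odd (trans (+-comm (q z * suc κ) _) (sym (m≡m%n+[m/n]*n (deg G z) (suc κ)))) ⟩
    odd (deg G z)                                 ∎
    where open ≡-Reasoning
  PC = parity-colouring G packed T T-even T-total
  c = proj₁ PC
  par = proj₂ PC

-- X stands for the colour class in TreeConnected, whose local definition cannot be named here.
fromTrees : ∀ {n m κ t} (G : Graph n m) → κ ≤ t →
  (X : (Fin m → Maybe (Fin t)) → Fin t → Fin m → Bool) →
  (∀ a j e → X a j e ≡ X (λ _ → a e) j e) →
  (∀ j e → X (λ _ → nothing) j e ≡ false) →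
  (∀ i j e → X (λ _ → just i) j e ≡ eqᵇ i j) →
  Σ[ a ∈ (Fin m → Maybe (Fin t)) ] (∀ j → SpanningTree G (X a j)) → Packed G κ
fromTrees {κ = κ} G κ≤t X local none one (a , trees) = record
  { part = λ i → X a (inject≤ i κ≤t)
  ; connected = λ i → proj₁ (trees (inject≤ i κ≤t))
  ; disjoint = λ i j e p q → Finₚ.inject≤-injective κ≤t κ≤t i j
      (unique e (a e) _ _ (trans (sym (local a _ e)) p) (trans (sym (local a _ e)) q)) }
  where
  unique : ∀ e x i j → X (λ _ → x) i e ≡ true → X (λ _ → x) j e ≡ true → i ≡ j
  unique e nothing  i j p q = ⊥-elim (true≢false p (none i e))
  unique e (just l) i j p q = trans (sym (eqᵇ-≡ {u = l} {i} (trans (sym (one l i e)) p))) (eqᵇ-≡ {u = l} {j} (trans (sym (one l j e)) q))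

treePacked : ∀ {n m κ t} (G : Graph n m) → κ ≤ t → TreeConnected G t → Packed G κ
treePacked G κ≤t = fromTrees G κ≤t _ (λ _ _ _ → refl) (λ _ _ → refl) (λ _ _ _ → refl)

-- `packing` needs a colour to start from, so `κ = 0`, with nothing to pack, is split off.
edgePacked : ∀ {n m} κ (G : Graph n m) → EdgeConnected G (κ + κ) → ¬ ¬ Packed G κ
edgePacked zero    G conn k = k (record { part = λ () ; connected = λ () ; disjoint = λ () })
edgePacked (suc t) G conn k = packing _ t G ≤-refl conn λ (a , ca) → k record
  { part = colour a ; connected = ca
  ; disjoint = λ i j e p q → trans (sym (colour-≡ a e p)) (colour-≡ a e q) }

-- Colourings are built value by value with `cons`. A given colouring agrees with the rebuilt one
-- only pointwise, whence `resp`.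
search : ∀ m {k} (P : (Fin m → Fin k) → Set) → (∀ {c c'} → (∀ e → c e ≡ c' e) → P c → P c') →
  (∀ c → Dec (P c)) → Dec (∃ P)
search zero {k} P resp P? = map′ (λ p → ∅ , p) (λ (c , p) → resp (λ ()) p) (P? ∅)
  where
  ∅ : Fin 0 → Fin k
  ∅ ()
search (suc m) {k} P resp P? = map′
  (λ (i , c , p) → cons i c , p)
  (λ (c , p) → c zero , c ∘ suc , resp (λ { zero → refl ; (suc e) → refl }) p)
  (any? λ i → search m (λ c → P (cons i c)) (λ h → resp (λ { zero → refl ; (suc e) → h e })) (λ c → P? (cons i c)))
  where
  cons : Fin k → (Fin m → Fin k) → Fin (suc m) → Fin k
  cons i c zero    = i
  cons i c (suc e) = c e

closeTo? : ∀ k x y → Dec (CloseTo k x y)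
closeTo? k x y = (k * x <? y + k) ×-dec (y <? k * x + k)

equitable? : ∀ {n m k} (G : Graph n m) → Dec (∃ (Equitable {k = k} G))
equitable? {n} {m} {k} G = search m (Equitable G)
  (λ h (s , d) → (λ i → subst (λ x → CloseTo k x m) (sum-cong (λ e → cong (λ x → ⟦ eqᵇ x i ⟧) (h e))) (s i))
               , (λ i v → subst (λ x → CloseTo k x (deg G v)) (degIn-cong G (λ e → cong (λ x → eqᵇ x i) (h e)) v) (d i v)))
  (λ c → all? (λ i → closeTo? k (count (colour c i)) m)
    ×-dec all? (λ i → all? (λ v → closeTo? k (degIn G (colour c i) v) (deg G v))))

theorem3p3 : (n m : ℕ) (G : Graph n m) (k : ℕ) .{{_ : NonZero k}} →
    ((EdgeConnected G (3 * k ∸ 3) ⊎ TreeConnected G (2 * k ∸ 2))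
    ⊎ (Loopless G × EdgeConnected G (2 * k ∸ 1) × EssEdgeConnected G (3 * k ∸ 3))) →
    (Z : Fin n → Bool) → m % k ≡ degSum G Z % k →
    Σ[ c ∈ (Fin m → Fin k) ]
    (((i : Fin k) → CloseTo k (count (colour c i)) m)
    × ((i : Fin k) (v : Fin n) → CloseTo k (degIn G (colour c i) v) (deg G v)))
theorem3p3 n m G (suc κ) hyp Z cong-m = decidable-stable (equitable? G) λ none →
  packed hyp λ P → none (packed-equitable G P Z cong-m)
  where
  -- Expanded so that the truncated subtractions compute: in terms of `κ` the three bounds are `3κ`,
  -- `2κ` and `2κ + 1`.
  2k : 2 * suc κ ≡ 2 + (κ + κ)
  2k = solve 1 (λ κ → con 2 :* (con 1 :+ κ) := con 2 :+ (κ :+ κ)) refl κ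
    where open +-*-Solver hiding (⟦_⟧)
  3k : 3 * suc κ ≡ 3 + (κ + κ + κ)
  3k = solve 1 (λ κ → con 3 :* (con 1 :+ κ) := con 3 :+ (κ :+ κ :+ κ)) refl κ
    where open +-*-Solver hiding (⟦_⟧)
  connected : ∀ {l} → κ + κ ≤ l → EdgeConnected G l → ¬ ¬ Packed G κ
  connected le conn = edgePacked κ G λ S p → ≤-trans le (conn S p)
  packed : (EdgeConnected G (3 * suc κ ∸ 3) ⊎ TreeConnected G (2 * suc κ ∸ 2))
    ⊎ (Loopless G × EdgeConnected G (2 * suc κ ∸ 1) × EssEdgeConnected G (3 * suc κ ∸ 3)) → ¬ ¬ Packed G κ
  packed (inj₁ (inj₁ conn)) = connected (subst (λ x → κ + κ ≤ x ∸ 3) (sym 3k) (m≤m+n (κ + κ) κ)) conn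
  packed (inj₁ (inj₂ trees)) k = k (treePacked G (subst (λ x → κ ≤ x ∸ 2) (sym 2k) (m≤m+n κ κ)) trees)
  packed (inj₂ (_ , conn , _)) = connected (subst (λ x → κ + κ ≤ x ∸ 1) (sym 2k) (n≤1+n (κ + κ))) conn
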